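{- For each variety $\mathbf{K}\in\Xi(\mathbf{S4})$, $$\mathsf{Log}(\sigma(\rho(\mathbf{K})))=Schem(\mathsf{Log}(\mathbf{K})^{\Box}).$$ Consequently, a logic (in the sense of axiomatic extension) $L\in\mathbf{NExt}(\mathsf{S4})$ is $\Box$-maximal if and only if it is the greatest modal companion of $\rho(L)$.
   Context: $\mathbf{S4}$ is the variety of S4-algebras: Boolean algebras with a unary $\Box$ satisfying $\Box1=1$, $\Box(a\wedge b)=\Box a\wedge\Box b$, $\Box a\le a$, $\Box a\le\Box\Box a$. In this statement $\Xi(\mathbf{S4})$ is the lattice of subvarieties of $\mathbf{S4}$. $\mathbf{NExt}(\mathsf{S4})$ is the lattice of normal axiomatic extensions of $\mathsf{S4}$ (sets of modal formulas), and $\Lambda(\mathsf{IPC})$ is the lattice of axiomatic extensions (superintuitionistic logics) of $\mathsf{IPC}$. For a class $\mathbf{K}$ of algebras, $\mathsf{Log}(\mathbf{K})$ is the set of formulas $\phi$ such that $\phi\approx1$ is valid in all members of $\mathbf{K}$. The translation $GMT$ from intuitionistic to modal formulas: $GMT(p)=\Box p$, $GMT(\top)=\top$, $GMT(\bot)=\bot$, $GMT$ commutes with $\wedge,\vee$, and $GMT(\phi\to\psi)=\Box(\neg GMT(\phi)\vee GMT(\psi))$. $M\in\mathbf{NExt}(\mathsf{S4})$ is a modal companion of $L\in\Lambda(\mathsf{IPC})$ if for all intuitionistic $\phi$: $\phi\in L\iff GMT(\phi)\in M$. For $M\in\mathbf{NExt}(\mathsf{S4})$, $\rho(M)=\{\phi:GMT(\phi)\in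 M\}\in\Lambda(\mathsf{IPC})$. For an S4-algebra $\mathcal{B}$, $\mathcal{B}_\Box=\{a\in B:a=\Box a\}$ is a Heyting algebra with the inherited $0,1,\wedge,\vee$ and implication $\Box(\neg a\vee b)$. For a variety $\mathbf{K}$ of S4-algebras, $\rho(\mathbf{K})=\{\mathcal{B}_\Box:\mathcal{B}\in\mathbf{K}\}$. For a Heyting algebra $\mathcal{H}$, $B(\mathcal{H})$ is its Boolean envelope: the Boolean algebra generated by $\mathcal{H}$, realized inside the powerset of the set of prime filters of $\mathcal{H}$ via $a\mapsto\{x:a\in x\}$, with $\Box\bigl(\bigwedge_{i=1}^n(\neg c_i\vee d_i)\bigr)=\bigwedge_{i=1}^n(c_i\to d_i)$ for $c_i,d_i\in H$, where $\to$ is Heyting implication; it is an S4-algebra. For a variety $\mathbf{P}$ of Heyting algebras, $\sigma(\mathbf{P})=\mathbb{HSP}\{B(\mathcal{H}):\mathcal{H}\in\mathbf{P}\}$. For $L\in\mathbf{NExt}(\mathsf{S4})$, its $\Box$-variant is $L^\Box=\{\phi:\phi[\Box\overline p/\overline p]\in L\}$, where $\phi[\Box\overline p/\overline p]$ substitutes $\Box q$ for each proposition letter $q$. For a $\Box$-variant $L'$, $Schem(L')=\{\phi:\forall\overline\psi,\ \phi[\overline\psi/\overline p]\in L'\}$, with $\overline\psi$ ranging over substitutions of modal formulas for proposition letters. $L$ is $\Box$-maximal if for every $S\in\mathbf{NExt}(\mathsf{S4})$, $L^\Box=S^\Box$ implies $S\subseteq L$. -}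

module Defs where

open import Level using (Level; _⊔_; suc; 0ℓ)
open import Data.Bool.Base using (Bool; T)
open import Data.Bool.Properties using (∨-∧-booleanAlgebra)
open import Data.List.Base using (List; foldr; map)
open import Data.Nat.Base using (ℕ)
open import Data.Product.Base using (Σ; ∃; ∃-syntax; _×_; _,_; proj₁; proj₂)
open import Data.Sum.Base using (_⊎_)
open import Function.Base using (_on_)
open import Function.Bundles using (_⇔_)
open import Function.Definitions using (Bijective; Injective; Surjective)
open import Relation.Nullary.Negation using () renaming (¬_ to Not)
open import Relation.Unary using (Pred; _∈_; _⊆_; _≐_)
open import Relation.Binary.Bundles using (Poset)
open import Relation.Binary.Lattice.Bundles using (HeytingAlgebra)
open import Algebra.Core using (Op₁)
open import Algebra.Lattice.Bundles using (BooleanAlgebra)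
open import Algebra.Lattice.Morphism.Structures using (IsLatticeHomomorphism)
open import Algebra.Morphism.Definitions using (Homomorphic₀; Homomorphic₁; Homomorphic₂)
import Algebra.Lattice.Properties.BooleanAlgebra as BooleanProperties
import Relation.Binary.Lattice.Structures as Order
import Relation.Binary.Reasoning.PartialOrder as ≤-Reasoning

------------------------------------------------------------------------
-- S4-algebras

module _ {c ℓ} (B : BooleanAlgebra c ℓ) where
  open BooleanAlgebra B
  open BooleanProperties B using (poset)
  open Poset poset using (_≤_)

  -- The order is the lattice order of B, that is, a ≤ b unfolds to a ≈ a ∧ b.
  record IsS4Operator (□ : Op₁ Carrier) : Set (c ⊔ ℓ) where
    field
      □-cong : ∀ {a b} → a ≈ b → □ a ≈ □ b
      □-⊤    : □ ⊤ ≈ ⊤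
      □-∧    : ∀ a b → □ (a ∧ b) ≈ □ a ∧ □ b
      □-T    : ∀ a → □ a ≤ a
      □-4    : ∀ a → □ a ≤ □ (□ a)

record S4Algebra (c ℓ : Level) : Set (suc (c ⊔ ℓ)) where
  field
    booleanAlgebra : BooleanAlgebra c ℓ
  open BooleanAlgebra booleanAlgebra public
  field
    □            : Op₁ Carrier
    isS4Operator : IsS4Operator booleanAlgebra □
  open IsS4Operator isS4Operator public

module _ {c ℓ} (A B : S4Algebra c ℓ) where
  private
    module A = S4Algebra A
    module B = S4Algebra B

  record IsS4Homomorphism (f : A.Carrier → B.Carrier) : Set (c ⊔ ℓ) where
    field
      isLatticeHomomorphism : IsLatticeHomomorphism A.rawLattice B.rawLattice f
      ⊤-homo : Homomorphic₀ A.Carrier B.Carrier B._≈_ f A.⊤ B.⊤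
      ⊥-homo : Homomorphic₀ A.Carrier B.Carrier B._≈_ f A.⊥ B.⊥
      ¬-homo : Homomorphic₁ A.Carrier B.Carrier B._≈_ f A.¬_ B.¬_
      □-homo : Homomorphic₁ A.Carrier B.Carrier B._≈_ f A.□ B.□
    open IsLatticeHomomorphism isLatticeHomomorphism public

  _↪_ _↠_ _≅_ : Set (c ⊔ ℓ)
  _↪_ = ∃[ f ] IsS4Homomorphism f × Injective A._≈_ B._≈_ f
  _↠_ = ∃[ f ] IsS4Homomorphism f × Surjective A._≈_ B._≈_ f
  _≅_ = ∃[ f ] IsS4Homomorphism f × Bijective A._≈_ B._≈_ f

------------------------------------------------------------------------
-- Products and varieties

∏ᴮ : ∀ {i c ℓ} {I : Set i} → (I → BooleanAlgebra c ℓ) → BooleanAlgebra (i ⊔ c) (i ⊔ ℓ)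
∏ᴮ {I = I} B = record
  { Carrier = ∀ i → B.Carrier i
  ; _≈_ = λ a b → ∀ i → B._≈_ i (a i) (b i)
  ; _∨_ = λ a b i → B._∨_ i (a i) (b i)
  ; _∧_ = λ a b i → B._∧_ i (a i) (b i)
  ; ¬_  = λ a i → B.¬_ i (a i)
  ; ⊤   = λ i → B.⊤ i
  ; ⊥   = λ i → B.⊥ i
  ; isBooleanAlgebra = record
    { isDistributiveLattice = record
      { isLattice = record
        { isEquivalence = record
          { refl  = λ i → B.refl i
          ; sym   = λ p i → B.sym i (p i)
          ; trans = λ p q i → B.trans i (p i) (q i)
          }
        ; ∨-comm  = λ a b i → B.∨-comm i (a i) (b i)
        ; ∨-assoc = λ a b c i → B.∨-assoc i (a i) (b i) (c i)
        ; ∨-cong  = λ p q i → B.∨-cong i (p i) (q i)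
        ; ∧-comm  = λ a b i → B.∧-comm i (a i) (b i)
        ; ∧-assoc = λ a b c i → B.∧-assoc i (a i) (b i) (c i)
        ; ∧-cong  = λ p q i → B.∧-cong i (p i) (q i)
        ; absorptive = (λ a b i → B.∨-absorbs-∧ i (a i) (b i))
                     , (λ a b i → B.∧-absorbs-∨ i (a i) (b i))
        }
      ; ∨-distrib-∧ = (λ a b c i → B.∨-distribˡ-∧ i (a i) (b i) (c i))
                    , (λ a b c i → B.∨-distribʳ-∧ i (a i) (b i) (c i))
      ; ∧-distrib-∨ = (λ a b c i → B.∧-distribˡ-∨ i (a i) (b i) (c i))
                    , (λ a b c i → B.∧-distribʳ-∨ i (a i) (b i) (c i))
      }
    ; ∨-complement = (λ a i → B.∨-complementˡ i (a i)) , (λ a i → B.∨-complementʳ i (a i))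
    ; ∧-complement = (λ a i → B.∧-complementˡ i (a i)) , (λ a i → B.∧-complementʳ i (a i))
    ; ¬-cong = λ p i → B.¬-cong i (p i)
    }
  }
  where module B (i : I) = BooleanAlgebra (B i)

∏ : ∀ {i c ℓ} {I : Set i} → (I → S4Algebra c ℓ) → S4Algebra (i ⊔ c) (i ⊔ ℓ)
∏ {I = I} A = record
  { booleanAlgebra = ∏ᴮ λ i → A.booleanAlgebra i
  ; □ = λ a i → A.□ i (a i)
  ; isS4Operator = record
    { □-cong = λ p i → A.□-cong i (p i)
    ; □-⊤    = λ i → A.□-⊤ i
    ; □-∧    = λ a b i → A.□-∧ i (a i) (b i)
    ; □-T    = λ a i → A.□-T i (a i)
    ; □-4    = λ a i → A.□-4 i (a i)
    }
  }
  where module A (i : I) = S4Algebra (A i)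

-- Fixing a universe level ℓ as "the sets", a class of S4-algebras is a
-- predicate on S4Algebra ℓ ℓ; products are over index sets in Set ℓ.

module _ {ℓ k} (K : Pred (S4Algebra ℓ ℓ) k) where

  ℍ 𝕊 ℙ : Pred (S4Algebra ℓ ℓ) (suc ℓ ⊔ k)
  ℍ B = ∃[ A ] A ∈ K × (A ↠ B)
  𝕊 B = ∃[ A ] A ∈ K × (B ↪ A)
  ℙ B = Σ (Set ℓ) λ I → Σ (I → S4Algebra ℓ ℓ) λ A → (∀ i → A i ∈ K) × (B ≅ ∏ A)

  record IsVariety : Set (suc ℓ ⊔ k) where
    field
      ℍ-closed : ℍ ⊆ K
      𝕊-closed : 𝕊 ⊆ K
      ℙ-closed : ℙ ⊆ K

------------------------------------------------------------------------
-- The Heyting algebra of open elements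

module _ {c ℓ} (B : S4Algebra c ℓ) where
  open S4Algebra B
  open BooleanProperties booleanAlgebra
    using (poset; ∨-∧-isOrderTheoreticLattice; ∧-identityʳ; ∧-zeroˡ; ∨-identityˡ)
  private
    module L = Order.IsLattice ∨-∧-isOrderTheoreticLattice
    open ≤-Reasoning poset
    open Poset poset using (_≤_)

    □-mono : ∀ {a b} → a ≤ b → □ a ≤ □ b
    □-mono {a} {b} a≤b = trans (□-cong a≤b) (□-∧ a b)

    □-open : ∀ a → □ a ≈ □ (□ a)
    □-open a = L.antisym (□-4 a) (□-T (□ a))

    ∨-mono : ∀ {a b a′ b′} → a ≤ a′ → b ≤ b′ → a ∨ b ≤ a′ ∨ b′
    ∨-mono p q = L.∨-least (L.trans p (L.x≤x∨y _ _)) (L.trans q (L.y≤x∨y _ _))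

    ∨-open : ∀ {a b} → a ≈ □ a → b ≈ □ b → a ∨ b ≈ □ (a ∨ b)
    ∨-open {a} {b} p q = L.antisym
      (begin
        a ∨ b       ≈⟨ ∨-cong p q ⟩
        □ a ∨ □ b   ≤⟨ L.∨-least (□-mono (L.x≤x∨y a b)) (□-mono (L.y≤x∨y a b)) ⟩
        □ (a ∨ b)   ∎)
      (□-T (a ∨ b))

    ⊤-max : ∀ a → a ≤ ⊤
    ⊤-max a = sym (∧-identityʳ a)

    ⊥-min : ∀ a → ⊥ ≤ a
    ⊥-min a = sym (∧-zeroˡ a)

    curry : ∀ w x y → w ≈ □ w → w ∧ x ≤ y → w ≤ □ (¬ x ∨ y)
    curry w x y w-open p = begin
      w            ≈⟨ w-open ⟩
      □ w          ≤⟨ □-mono (begin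
        w                       ≈⟨ ∧-identityʳ w ⟨
        w ∧ ⊤                   ≈⟨ ∧-congˡ (∨-complementˡ x) ⟨
        w ∧ (¬ x ∨ x)           ≈⟨ ∧-distribˡ-∨ w (¬ x) x ⟩
        (w ∧ ¬ x) ∨ (w ∧ x)     ≤⟨ ∨-mono (L.x∧y≤y w (¬ x)) p ⟩
        ¬ x ∨ y                 ∎) ⟩
      □ (¬ x ∨ y)  ∎

    uncurry : ∀ w x y → w ≤ □ (¬ x ∨ y) → w ∧ x ≤ y
    uncurry w x y p = begin
      w ∧ x                 ≤⟨ L.∧-greatest (L.trans (L.x∧y≤x w x) (L.trans p (□-T _))) (L.x∧y≤y w x) ⟩
      (¬ x ∨ y) ∧ x         ≈⟨ ∧-distribʳ-∨ x (¬ x) y ⟩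
      (¬ x ∧ x) ∨ (y ∧ x)   ≈⟨ ∨-congʳ (∧-complementˡ x) ⟩
      ⊥ ∨ (y ∧ x)           ≈⟨ ∨-identityˡ _ ⟩
      y ∧ x                 ≤⟨ L.x∧y≤x y x ⟩
      y                     ∎

  opens : HeytingAlgebra (c ⊔ ℓ) ℓ ℓ
  opens = record
    { Carrier = ∃[ a ] a ≈ □ a
    ; _≈_ = _≈_ on proj₁
    ; _≤_ = _≤_ on proj₁
    ; _∨_ = λ (a , p) (b , q) → a ∨ b , ∨-open p q
    ; _∧_ = λ (a , p) (b , q) → a ∧ b , trans (∧-cong p q) (sym (□-∧ a b))
    ; _⇨_ = λ (a , _) (b , _) → □ (¬ a ∨ b) , □-open (¬ a ∨ b)
    ; ⊤ = ⊤ , sym □-⊤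
    ; ⊥ = ⊥ , L.antisym (⊥-min (□ ⊥)) (□-T ⊥)
    ; isHeytingAlgebra = record
      { isBoundedLattice = record
        { isLattice = record
          { isPartialOrder = record
            { isPreorder = record
              { isEquivalence = record { refl = refl ; sym = sym ; trans = trans }
              ; reflexive = L.reflexive
              ; trans = L.trans
              }
            ; antisym = L.antisym
            }
          ; supremum = λ (a , _) (b , _) →
              L.x≤x∨y a b , L.y≤x∨y a b , λ _ → L.∨-least
          ; infimum = λ (a , _) (b , _) →
              L.x∧y≤x a b , L.x∧y≤y a b , λ _ → L.∧-greatest
          }
        ; maximum = λ (a , _) → ⊤-max a
        ; minimum = λ (a , _) → ⊥-min a
        }
      ; exponential = λ (w , p) (x , _) (y , _) → curry w x y p , uncurry w x y
      }
    }

module _ {c ℓ₁ ℓ₂} (G H : HeytingAlgebra c ℓ₁ ℓ₂) where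
  private
    module G = HeytingAlgebra G
    module H = HeytingAlgebra H

  record IsHeytingHomomorphism (f : G.Carrier → H.Carrier) : Set (c ⊔ ℓ₁) where
    field
      cong   : ∀ {a b} → a G.≈ b → f a H.≈ f b
      ∧-homo : Homomorphic₂ G.Carrier H.Carrier H._≈_ f G._∧_ H._∧_
      ∨-homo : Homomorphic₂ G.Carrier H.Carrier H._≈_ f G._∨_ H._∨_
      ⇨-homo : Homomorphic₂ G.Carrier H.Carrier H._≈_ f G._⇨_ H._⇨_
      ⊤-homo : Homomorphic₀ G.Carrier H.Carrier H._≈_ f G.⊤ H.⊤
      ⊥-homo : Homomorphic₀ G.Carrier H.Carrier H._≈_ f G.⊥ H.⊥

  _≅ᴴ_ : Set (c ⊔ ℓ₁)
  _≅ᴴ_ = ∃[ f ] IsHeytingHomomorphism f × Bijective G._≈_ H._≈_ f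

------------------------------------------------------------------------
-- The Boolean envelope

-- The Boolean subalgebra generated by the image of a map η.

module _ {i c ℓ} {I : Set i} (B : BooleanAlgebra c ℓ) (η : I → BooleanAlgebra.Carrier B) where
  open BooleanAlgebra B

  data Generated : Pred Carrier (i ⊔ c) where
    gen : ∀ x → Generated (η x)
    ⊤-gen : Generated ⊤
    ⊥-gen : Generated ⊥
    ∧-gen : ∀ {a b} → Generated a → Generated b → Generated (a ∧ b)
    ∨-gen : ∀ {a b} → Generated a → Generated b → Generated (a ∨ b)
    ¬-gen : ∀ {a} → Generated a → Generated (¬ a)

  subalgebra : BooleanAlgebra (i ⊔ c) ℓ
  subalgebra = record
    { Carrier = ∃ Generated
    ; _≈_ = _≈_ on proj₁
    ; _∨_ = λ (a , p) (b , q) → a ∨ b , ∨-gen p q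
    ; _∧_ = λ (a , p) (b , q) → a ∧ b , ∧-gen p q
    ; ¬_  = λ (a , p) → ¬ a , ¬-gen p
    ; ⊤   = ⊤ , ⊤-gen
    ; ⊥   = ⊥ , ⊥-gen
    ; isBooleanAlgebra = record
      { isDistributiveLattice = record
        { isLattice = record
          { isEquivalence = record { refl = refl ; sym = sym ; trans = trans }
          ; ∨-comm  = λ (a , _) (b , _) → ∨-comm a b
          ; ∨-assoc = λ (a , _) (b , _) (c , _) → ∨-assoc a b c
          ; ∨-cong  = ∨-cong
          ; ∧-comm  = λ (a , _) (b , _) → ∧-comm a b
          ; ∧-assoc = λ (a , _) (b , _) (c , _) → ∧-assoc a b c
          ; ∧-cong  = ∧-cong
          ; absorptive = (λ (a , _) (b , _) → ∨-absorbs-∧ a b)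
                       , (λ (a , _) (b , _) → ∧-absorbs-∨ a b)
          }
        ; ∨-distrib-∧ = (λ (a , _) (b , _) (c , _) → ∨-distribˡ-∧ a b c)
                      , (λ (a , _) (b , _) (c , _) → ∨-distribʳ-∧ a b c)
        ; ∧-distrib-∨ = (λ (a , _) (b , _) (c , _) → ∧-distribˡ-∨ a b c)
                      , (λ (a , _) (b , _) (c , _) → ∧-distribʳ-∨ a b c)
        }
      ; ∨-complement = (λ (a , _) → ∨-complementˡ a) , (λ (a , _) → ∨-complementʳ a)
      ; ∧-complement = (λ (a , _) → ∧-complementˡ a) , (λ (a , _) → ∧-complementʳ a)
      ; ¬-cong = ¬-cong
      }
    }

-- Subsets are given by characteristic functions.  This keeps the powerset
-- of a type in Set x inside Set x, and under excluded middle every subset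
-- has a characteristic function.

𝒫 : ∀ {x} → Set x → BooleanAlgebra x x
𝒫 X = ∏ᴮ λ (_ : X) → ∨-∧-booleanAlgebra

module _ {c ℓ₁ ℓ₂} (H : HeytingAlgebra c ℓ₁ ℓ₂) where
  open HeytingAlgebra H

  record PrimeFilter : Set (c ⊔ ℓ₂) where
    field
      χ : Carrier → Bool
    Member : Pred Carrier 0ℓ
    Member a = T (χ a)
    field
      upward : ∀ {a b} → a ≤ b → Member a → Member b
      ⊤-in   : Member ⊤
      ∧-in   : ∀ {a b} → Member a → Member b → Member (a ∧ b)
      ⊥-out  : Not (Member ⊥)
      prime  : ∀ {a b} → Member (a ∨ b) → Member a ⊎ Member b

  stone : Carrier → BooleanAlgebra.Carrier (𝒫 PrimeFilter)
  stone a x = PrimeFilter.χ x a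

  envelope : BooleanAlgebra (c ⊔ ℓ₂) (c ⊔ ℓ₂)
  envelope = subalgebra (𝒫 PrimeFilter) stone

  private module E = BooleanAlgebra envelope

  ι : Carrier → E.Carrier
  ι a = stone a , gen a

  clauses : List (Carrier × Carrier) → E.Carrier
  clauses cds = foldr E._∧_ E.⊤ (map (λ (c , d) → (E.¬ ι c) E.∨ ι d) cds)

  implications : List (Carrier × Carrier) → Carrier
  implications cds = foldr _∧_ ⊤ (map (λ (c , d) → c ⇨ d) cds)

  -- Every element of the envelope is a finite meet of clauses, so the last
  -- field determines □.  That the □ so described is well defined rests on the
  -- prime filter theorem, which is not available constructively; hence □ is a
  -- field here, and B(H) is the S4-algebra `algebra` below.
  record EnvelopeOperator : Set (c ⊔ ℓ₂) where
    field
      □            : Op₁ E.Carrier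
      isS4Operator : IsS4Operator envelope □
      □-clauses    : ∀ cds → □ (clauses cds) E.≈ ι (implications cds)

    algebra : S4Algebra (c ⊔ ℓ₂) (c ⊔ ℓ₂)
    algebra = record { isS4Operator = isS4Operator }

------------------------------------------------------------------------
-- ρ and σ on classes of algebras

-- Membership in { 𝓑_□ : 𝓑 ∈ K } is up to isomorphism.
ρᵛ : ∀ {ℓ k} → Pred (S4Algebra ℓ ℓ) k → Pred (HeytingAlgebra ℓ ℓ ℓ) (suc ℓ ⊔ k)
ρᵛ K H = ∃[ B ] B ∈ K × (opens B ≅ᴴ H)

data Envelopes {ℓ p} (P : Pred (HeytingAlgebra ℓ ℓ ℓ) p) : Pred (S4Algebra ℓ ℓ) (suc ℓ ⊔ p) where
  B[_,_] : ∀ {H} → H ∈ P → (E : EnvelopeOperator H) → EnvelopeOperator.algebra E ∈ Envelopes P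

σ : ∀ {ℓ p} → Pred (HeytingAlgebra ℓ ℓ ℓ) p → Pred (S4Algebra ℓ ℓ) (suc ℓ ⊔ p)
σ P = ℍ (𝕊 (ℙ (Envelopes P)))

------------------------------------------------------------------------
-- Formulas

infixr 7 _∧ᶠ_ _∧ⁱ_
infixr 6 _∨ᶠ_ _∨ⁱ_
infixr 5 _⇒ᶠ_ _⇒ⁱ_
infix  8 ¬ᶠ_ □ᶠ_

data Modal : Set where
  var       : ℕ → Modal
  ⊤ᶠ ⊥ᶠ     : Modal
  _∧ᶠ_ _∨ᶠ_ : Modal → Modal → Modal
  ¬ᶠ_ □ᶠ_   : Modal → Modal

_⇒ᶠ_ : Modal → Modal → Modal
φ ⇒ᶠ ψ = ¬ᶠ φ ∨ᶠ ψ

data Int : Set where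
  varⁱ           : ℕ → Int
  ⊤ⁱ ⊥ⁱ          : Int
  _∧ⁱ_ _∨ⁱ_ _⇒ⁱ_ : Int → Int → Int

_[_] : Modal → (ℕ → Modal) → Modal
var p    [ s ] = s p
⊤ᶠ       [ s ] = ⊤ᶠ
⊥ᶠ       [ s ] = ⊥ᶠ
(φ ∧ᶠ ψ) [ s ] = φ [ s ] ∧ᶠ ψ [ s ]
(φ ∨ᶠ ψ) [ s ] = φ [ s ] ∨ᶠ ψ [ s ]
(¬ᶠ φ)   [ s ] = ¬ᶠ (φ [ s ])
(□ᶠ φ)   [ s ] = □ᶠ (φ [ s ])

_[_]ⁱ : Int → (ℕ → Int) → Int
varⁱ p   [ s ]ⁱ = s p
⊤ⁱ       [ s ]ⁱ = ⊤ⁱ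
⊥ⁱ       [ s ]ⁱ = ⊥ⁱ
(φ ∧ⁱ ψ) [ s ]ⁱ = φ [ s ]ⁱ ∧ⁱ ψ [ s ]ⁱ
(φ ∨ⁱ ψ) [ s ]ⁱ = φ [ s ]ⁱ ∨ⁱ ψ [ s ]ⁱ
(φ ⇒ⁱ ψ) [ s ]ⁱ = φ [ s ]ⁱ ⇒ⁱ ψ [ s ]ⁱ

GMT : Int → Modal
GMT (varⁱ p) = □ᶠ (var p)
GMT ⊤ⁱ       = ⊤ᶠ
GMT ⊥ⁱ       = ⊥ᶠ
GMT (φ ∧ⁱ ψ) = GMT φ ∧ᶠ GMT ψ
GMT (φ ∨ⁱ ψ) = GMT φ ∨ᶠ GMT ψ
GMT (φ ⇒ⁱ ψ) = □ᶠ (¬ᶠ GMT φ ∨ᶠ GMT ψ)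

------------------------------------------------------------------------
-- The logic of a class of algebras

module _ {c ℓ} (A : S4Algebra c ℓ) where
  open S4Algebra A

  ⟦_⟧ : Modal → (ℕ → Carrier) → Carrier
  ⟦ var p ⟧  v = v p
  ⟦ ⊤ᶠ ⟧     v = ⊤
  ⟦ ⊥ᶠ ⟧     v = ⊥
  ⟦ φ ∧ᶠ ψ ⟧ v = ⟦ φ ⟧ v ∧ ⟦ ψ ⟧ v
  ⟦ φ ∨ᶠ ψ ⟧ v = ⟦ φ ⟧ v ∨ ⟦ ψ ⟧ v
  ⟦ ¬ᶠ φ ⟧   v = ¬ ⟦ φ ⟧ v
  ⟦ □ᶠ φ ⟧   v = □ (⟦ φ ⟧ v)

  _⊨_ : Modal → Set (c ⊔ ℓ)
  _⊨_ φ = ∀ v → ⟦ φ ⟧ v ≈ ⊤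

Log : ∀ {ℓ k} → Pred (S4Algebra ℓ ℓ) k → Pred Modal (suc ℓ ⊔ k)
Log K φ = ∀ {A} → A ∈ K → A ⊨ φ

------------------------------------------------------------------------
-- Logics

data IntuitionisticAxiom {F : Set} (⊤ ⊥ : F) (_∧_ _∨_ _⇒_ : F → F → F) : Pred F 0ℓ where
  K-axiom : ∀ φ ψ → IntuitionisticAxiom ⊤ ⊥ _∧_ _∨_ _⇒_ (φ ⇒ (ψ ⇒ φ))
  S-axiom : ∀ φ ψ χ → IntuitionisticAxiom ⊤ ⊥ _∧_ _∨_ _⇒_
              ((φ ⇒ (ψ ⇒ χ)) ⇒ ((φ ⇒ ψ) ⇒ (φ ⇒ χ)))
  ∧-fst   : ∀ φ ψ → IntuitionisticAxiom ⊤ ⊥ _∧_ _∨_ _⇒_ ((φ ∧ ψ) ⇒ φ)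
  ∧-snd   : ∀ φ ψ → IntuitionisticAxiom ⊤ ⊥ _∧_ _∨_ _⇒_ ((φ ∧ ψ) ⇒ ψ)
  ∧-pair  : ∀ φ ψ → IntuitionisticAxiom ⊤ ⊥ _∧_ _∨_ _⇒_ (φ ⇒ (ψ ⇒ (φ ∧ ψ)))
  ∨-inl   : ∀ φ ψ → IntuitionisticAxiom ⊤ ⊥ _∧_ _∨_ _⇒_ (φ ⇒ (φ ∨ ψ))
  ∨-inr   : ∀ φ ψ → IntuitionisticAxiom ⊤ ⊥ _∧_ _∨_ _⇒_ (ψ ⇒ (φ ∨ ψ))
  ∨-case  : ∀ φ ψ χ → IntuitionisticAxiom ⊤ ⊥ _∧_ _∨_ _⇒_
              ((φ ⇒ χ) ⇒ ((ψ ⇒ χ) ⇒ ((φ ∨ ψ) ⇒ χ)))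
  ⊤-intro : IntuitionisticAxiom ⊤ ⊥ _∧_ _∨_ _⇒_ ⊤
  ⊥-elim  : ∀ φ → IntuitionisticAxiom ⊤ ⊥ _∧_ _∨_ _⇒_ (⊥ ⇒ φ)

data IPC : Pred Int 0ℓ where
  axiom : ∀ {φ} → IntuitionisticAxiom ⊤ⁱ ⊥ⁱ _∧ⁱ_ _∨ⁱ_ _⇒ⁱ_ φ → φ ∈ IPC
  mp    : ∀ {φ ψ} → φ ∈ IPC → (φ ⇒ⁱ ψ) ∈ IPC → ψ ∈ IPC

-- Since φ ⇒ᶠ ψ is ¬ᶠ φ ∨ᶠ ψ, the two axioms for ¬ᶠ tie the primitive
-- negation to implication into ⊥ᶠ.
data S4 : Pred Modal 0ℓ where
  axiom   : ∀ {φ} → IntuitionisticAxiom ⊤ᶠ ⊥ᶠ _∧ᶠ_ _∨ᶠ_ _⇒ᶠ_ φ → φ ∈ S4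
  ¬-intro : ∀ φ → ((φ ⇒ᶠ ⊥ᶠ) ⇒ᶠ ¬ᶠ φ) ∈ S4
  ¬-elim  : ∀ φ → (¬ᶠ φ ⇒ᶠ (φ ⇒ᶠ ⊥ᶠ)) ∈ S4
  exm     : ∀ φ → (φ ∨ᶠ ¬ᶠ φ) ∈ S4
  □-K     : ∀ φ ψ → (□ᶠ (φ ⇒ᶠ ψ) ⇒ᶠ (□ᶠ φ ⇒ᶠ □ᶠ ψ)) ∈ S4
  □-T     : ∀ φ → (□ᶠ φ ⇒ᶠ φ) ∈ S4
  □-4     : ∀ φ → (□ᶠ φ ⇒ᶠ □ᶠ □ᶠ φ) ∈ S4
  mp      : ∀ {φ ψ} → φ ∈ S4 → (φ ⇒ᶠ ψ) ∈ S4 → ψ ∈ S4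
  nec     : ∀ {φ} → φ ∈ S4 → □ᶠ φ ∈ S4

record Λ⟨IPC⟩ {m} (L : Pred Int m) : Set m where
  field
    extends      : IPC ⊆ L
    mp-closed    : ∀ {φ ψ} → φ ∈ L → (φ ⇒ⁱ ψ) ∈ L → ψ ∈ L
    subst-closed : ∀ {φ} s → φ ∈ L → φ [ s ]ⁱ ∈ L

record NExt⟨S4⟩ {m} (L : Pred Modal m) : Set m where
  field
    extends      : S4 ⊆ L
    mp-closed    : ∀ {φ ψ} → φ ∈ L → (φ ⇒ᶠ ψ) ∈ L → ψ ∈ L
    nec-closed   : ∀ {φ} → φ ∈ L → □ᶠ φ ∈ L
    subst-closed : ∀ {φ} s → φ ∈ L → φ [ s ] ∈ L

------------------------------------------------------------------------
-- Modal companions and □-variants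

ρᴸ : ∀ {m} → Pred Modal m → Pred Int m
ρᴸ M φ = GMT φ ∈ M

record IsModalCompanion {m n} (M : Pred Modal m) (L : Pred Int n) : Set (m ⊔ n) where
  field
    normal              : NExt⟨S4⟩ M
    superintuitionistic : Λ⟨IPC⟩ L
    companion           : ∀ φ → φ ∈ L ⇔ GMT φ ∈ M

IsGreatestModalCompanion : ∀ {m n} → Pred Modal m → Pred Int n → Set (suc m ⊔ n)
IsGreatestModalCompanion {m} M L =
  IsModalCompanion M L × (∀ (S : Pred Modal m) → IsModalCompanion S L → S ⊆ M)

_^□ : ∀ {m} → Pred Modal m → Pred Modal m
(L ^□) φ = φ [ (λ p → □ᶠ (var p)) ] ∈ L

Schem : ∀ {m} → Pred Modal m → Pred Modal m
Schem L φ = ∀ s → φ [ s ] ∈ L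

□-Maximal : ∀ {m} → Pred Modal m → Set (suc m)
□-Maximal {m} L = ∀ (S : Pred Modal m) → NExt⟨S4⟩ S → L ^□ ≐ S ^□ → S ⊆ L

{-# OPTIONS --safe #-}
module Submission where

-- Everything rests on one computation.  Let D carry the operations of a Heyting
-- algebra and let j map D to an S4-algebra, respecting the lattice operations and
-- sending x ⇨ y to □ (¬ j x ∨ j y).  Boolean combinations of values of j are finite
-- meets of clauses ¬ j c ∨ j d, and □ of such a meet is j of the meet of the
-- c ⇨ d.  So every modal combination of values of j is again a meet of clauses, and
-- the list of pairs (c , d) is computed in D alone (nf-value).  The meet is ⊤ just
-- when j c ≤ j d for all pairs in the list.  Hence, for two maps j₁ and j₂ on the
-- same D, if j₁ c ≤ j₁ d implies j₂ c ≤ j₂ d, then a modal combination that is ⊤ for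
-- j₁ is ⊤ for j₂ (truth-transfer).
--
-- A formula φ belongs to Schem (Log K ^□) when every member of K makes φ true at all
-- valuations by modal combinations of open elements (⟦⟧-[□]).
--
-- For the inclusion of Schem (Log K ^□) in Log (σ (ρᵛ K)), the operators ℍ, 𝕊 and ℙ
-- preserve validity, so an envelope of some H isomorphic to the opens of B ∈ K is all
-- that matters.  Elements of the envelope are meets of clauses with entries in H, and
-- transfer goes from B to the envelope (EnvelopeOfOpens.valid).  Countably many
-- entries are coded into one valuation by a pairing of natural numbers.
--
-- For the converse inclusion, let φ ∈ Log (σ (ρᵛ K)), and take B ∈ K with a valuation
-- v.  The subalgebra C of B generated by v is in K and is countable.  Prime filters of
-- the opens of C can therefore be built one element at a time, with excluded middle
-- as the only classical principle, and the Stone map of the opens of C is an order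
-- embedding (ι-reflects-≤).  For such a Heyting algebra the embedding into the
-- envelope has a right adjoint, which gives the envelope its □ (envelopeOperator).
-- Transfer then goes from the envelope, where φ is valid, to C.
--
-- For the statement on maximality, take D to be the intuitionistic formulas, the
-- Lindenbaum algebra of S4 as target, and GMT as j.  The computation turns
-- □ (φ [□p/p]) into GMT ψ for an intuitionistic formula ψ (□-[□]).  So the
-- companions of an intuitionistic logic agree on □-variants (ρᴸ⊆⇒^□⊆).  Conversely
-- GMT ψ is equivalent to its own □-variant, and logics with the same □-variant have
-- the same intuitionistic fragment (^□⊆⇒ρᴸ⊆).

open import Defs
open import Axiom.ExcludedMiddle using (ExcludedMiddle)
open import Data.Product.Base using (_×_)
open import Function.Bundles using (_⇔_)
open import Relation.Unary using (Pred; _≐_)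

open import Level using (Level; _⊔_; 0ℓ; Lift; lift) renaming (suc to lsuc)
open import Algebra.Lattice.Bundles using (BooleanAlgebra)
import Algebra.Lattice.Properties.BooleanAlgebra as BooleanProperties
open import Algebra.Lattice.Structures.Biased using (isDistributiveLatticeʳʲᵐ; isBooleanAlgebraʳ)
open import Data.Bool.Base as Bool using (Bool; true; false; T)
open import Data.List.Base using (List; []; _∷_; _++_; foldr; map)
open import Data.Nat.Base as ℕ using (ℕ; zero; suc; _≤′_; ≤′-refl; ≤′-step)
import Data.Nat.Properties as ℕ
open import Data.Product.Base using (∃-syntax; _,_; proj₁; proj₂; map₂)
open import Data.Sum.Base using (_⊎_; inj₁; inj₂)
import Data.Unit.Polymorphic.Base as Unit
open import Function.Base using (_∘_; _on_; id)
open import Function.Bundles using (mk⇔; module Equivalence)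
open import Relation.Binary.Bundles using (Poset)
open import Relation.Binary.Lattice.Bundles using (HeytingAlgebra)
import Relation.Binary.Lattice.Properties.DistributiveLattice as DistributiveLatticeProperties
import Relation.Binary.Lattice.Properties.HeytingAlgebra as HeytingProperties
import Relation.Binary.Lattice.Properties.Lattice as LatticeProperties
import Relation.Binary.Lattice.Structures as Order
open import Relation.Binary.PropositionalEquality as ≡ using (_≡_)
import Relation.Binary.Reasoning.PartialOrder as ≤-Reasoning
import Relation.Binary.Reasoning.Setoid as ≈-Reasoning
open import Relation.Nullary.Decidable using (Dec; yes; no; ⌊_⌋; toWitness; fromWitness)
open import Relation.Nullary.Negation using (contradiction) renaming (¬_ to Not)
open import Relation.Unary using (_∈_; _⊆_)

private
  variable
    a c ℓ ℓ₁ ℓ₂ k : Level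

-- Order in a Boolean algebra

module BooleanOrder (B : BooleanAlgebra c ℓ) where
  open BooleanAlgebra B
  open BooleanProperties B public
    using ( poset; ∨-∧-isOrderTheoreticLattice; ∧-identityˡ; ∧-identityʳ; ∨-identityˡ
          ; ∨-zeroʳ; ¬⊤≈⊥; ¬-involutive; deMorgan₁; deMorgan₂ )
  open Poset poset public using (_≤_)
    renaming (refl to ≤-refl; trans to ≤-trans; reflexive to ≤-reflexive)
  open Order.IsLattice ∨-∧-isOrderTheoreticLattice public
    using (antisym; x≤x∨y; y≤x∨y; ∨-least; x∧y≤x; x∧y≤y; ∧-greatest)

  ≤-⊤ : ∀ {x} → x ≤ ⊤
  ≤-⊤ = sym (∧-identityʳ _)

  ⊤≤⇒≈⊤ : ∀ {x} → ⊤ ≤ x → x ≈ ⊤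
  ⊤≤⇒≈⊤ = antisym ≤-⊤

  transpose-∨ : ∀ {w x y} → w ∧ x ≤ y → w ≤ ¬ x ∨ y
  transpose-∨ {w} {x} {y} p = ≤-trans
    (≤-reflexive (begin
      w                    ≈⟨ ∧-identityʳ w ⟨
      w ∧ ⊤                ≈⟨ ∧-congˡ (∨-complementˡ x) ⟨
      w ∧ (¬ x ∨ x)        ≈⟨ ∧-distribˡ-∨ w (¬ x) x ⟩
      (w ∧ ¬ x) ∨ (w ∧ x)  ∎))
    (∨-least (≤-trans (x∧y≤y _ _) (x≤x∨y _ _)) (≤-trans p (y≤x∨y _ _)))
    where open ≈-Reasoning setoid

  transpose-∧ : ∀ {w x y} → w ≤ ¬ x ∨ y → w ∧ x ≤ y
  transpose-∧ {w} {x} {y} p = ≤-trans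
    (∧-greatest (≤-trans (x∧y≤x w x) p) (x∧y≤y w x))
    (≤-trans
      (≤-reflexive (begin
        (¬ x ∨ y) ∧ x        ≈⟨ ∧-distribʳ-∨ x (¬ x) y ⟩
        (¬ x ∧ x) ∨ (y ∧ x)  ≈⟨ ∨-congʳ (∧-complementˡ x) ⟩
        ⊥ ∨ (y ∧ x)          ≈⟨ ∨-identityˡ _ ⟩
        y ∧ x                ∎))
      (x∧y≤x _ _))
    where open ≈-Reasoning setoid

  ≤⇒¬∨≈⊤ : ∀ {x y} → x ≤ y → ¬ x ∨ y ≈ ⊤
  ≤⇒¬∨≈⊤ p = ⊤≤⇒≈⊤ (transpose-∨ (≤-trans (x∧y≤y _ _) p))

  ¬∨≈⊤⇒≤ : ∀ {x y} → ¬ x ∨ y ≈ ⊤ → x ≤ y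
  ¬∨≈⊤⇒≤ {x} p = ≤-trans (≤-reflexive (sym (∧-identityˡ x))) (transpose-∧ (≤-reflexive (sym p)))

-- Evaluation of modal formulas

module _ (A : S4Algebra c ℓ) where
  open S4Algebra A

  ⟦⟧-cong : ∀ φ {v w} → (∀ p → v p ≈ w p) → ⟦_⟧ A φ v ≈ ⟦_⟧ A φ w
  ⟦⟧-cong (var p)  v≈w = v≈w p
  ⟦⟧-cong ⊤ᶠ       v≈w = refl
  ⟦⟧-cong ⊥ᶠ       v≈w = refl
  ⟦⟧-cong (φ ∧ᶠ ψ) v≈w = ∧-cong (⟦⟧-cong φ v≈w) (⟦⟧-cong ψ v≈w)
  ⟦⟧-cong (φ ∨ᶠ ψ) v≈w = ∨-cong (⟦⟧-cong φ v≈w) (⟦⟧-cong ψ v≈w)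
  ⟦⟧-cong (¬ᶠ φ)   v≈w = ¬-cong (⟦⟧-cong φ v≈w)
  ⟦⟧-cong (□ᶠ φ)   v≈w = □-cong (⟦⟧-cong φ v≈w)

  ⟦⟧-[] : ∀ φ s v → ⟦_⟧ A (φ [ s ]) v ≡ ⟦_⟧ A φ (λ p → ⟦_⟧ A (s p) v)
  ⟦⟧-[] (var p)  s v = ≡.refl
  ⟦⟧-[] ⊤ᶠ       s v = ≡.refl
  ⟦⟧-[] ⊥ᶠ       s v = ≡.refl
  ⟦⟧-[] (φ ∧ᶠ ψ) s v = ≡.cong₂ _∧_ (⟦⟧-[] φ s v) (⟦⟧-[] ψ s v)
  ⟦⟧-[] (φ ∨ᶠ ψ) s v = ≡.cong₂ _∨_ (⟦⟧-[] φ s v) (⟦⟧-[] ψ s v)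
  ⟦⟧-[] (¬ᶠ φ)   s v = ≡.cong ¬_ (⟦⟧-[] φ s v)
  ⟦⟧-[] (□ᶠ φ)   s v = ≡.cong □ (⟦⟧-[] φ s v)

  -- Membership of φ in Schem (Log K ^□) is, for each member A of K, truth of φ
  -- at all valuations by modal combinations of values □ (v n).
  ⟦⟧-[□] : ∀ φ s v → ⟦_⟧ A ((φ [ s ]) [ (λ p → □ᶠ (var p)) ]) v
                   ≡ ⟦_⟧ A φ (λ p → ⟦_⟧ A (s p) (□ ∘ v))
  ⟦⟧-[□] φ s v = ≡.trans (⟦⟧-[] (φ [ s ]) _ v) (⟦⟧-[] φ s (□ ∘ v))

module _ {A B : S4Algebra c ℓ} {f : S4Algebra.Carrier A → S4Algebra.Carrier B}
         (f-homo : IsS4Homomorphism A B f) where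
  open S4Algebra B
  open IsS4Homomorphism f-homo

  ⟦⟧-homo : ∀ φ v → f (⟦_⟧ A φ v) ≈ ⟦_⟧ B φ (f ∘ v)
  ⟦⟧-homo (var p)  v = refl
  ⟦⟧-homo ⊤ᶠ       v = ⊤-homo
  ⟦⟧-homo ⊥ᶠ       v = ⊥-homo
  ⟦⟧-homo (φ ∧ᶠ ψ) v = trans (∧-homo _ _) (∧-cong (⟦⟧-homo φ v) (⟦⟧-homo ψ v))
  ⟦⟧-homo (φ ∨ᶠ ψ) v = trans (∨-homo _ _) (∨-cong (⟦⟧-homo φ v) (⟦⟧-homo ψ v))
  ⟦⟧-homo (¬ᶠ φ)   v = trans (¬-homo _) (¬-cong (⟦⟧-homo φ v))
  ⟦⟧-homo (□ᶠ φ)   v = trans (□-homo _) (□-cong (⟦⟧-homo φ v))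

module _ {A : S4Algebra a ℓ₁} where
  open S4Algebra A

  id-isS4Homomorphism : IsS4Homomorphism A A id
  id-isS4Homomorphism = record
    { isLatticeHomomorphism = record
      { isRelHomomorphism = record { cong = id }
      ; ∧-homo = λ _ _ → refl
      ; ∨-homo = λ _ _ → refl
      }
    ; ⊤-homo = refl
    ; ⊥-homo = refl
    ; ¬-homo = λ _ → refl
    ; □-homo = λ _ → refl
    }

-- Validity in generated varieties

module _ (K : Pred (S4Algebra ℓ ℓ) k) where

  Log-ℍ : Log K ⊆ Log (ℍ K)
  Log-ℍ {φ} φ∈ {B} (A , A∈K , f , f-homo , f-surj) v = begin
    ⟦_⟧ B φ v        ≈⟨ ⟦⟧-cong B φ (λ p → f-lift p) ⟨
    ⟦_⟧ B φ (f ∘ w)  ≈⟨ ⟦⟧-homo f-homo φ w ⟨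
    f (⟦_⟧ A φ w)    ≈⟨ F.⟦⟧-cong (φ∈ A∈K w) ⟩
    f A.⊤            ≈⟨ F.⊤-homo ⟩
    B.⊤              ∎
    where
    module A = S4Algebra A
    module B = S4Algebra B
    module F = IsS4Homomorphism f-homo
    open ≈-Reasoning B.setoid
    w = λ p → proj₁ (f-surj (v p))
    f-lift : ∀ p → f (w p) B.≈ v p
    f-lift p = proj₂ (f-surj (v p)) A.refl

  Log-𝕊 : Log K ⊆ Log (𝕊 K)
  Log-𝕊 {φ} φ∈ {B} (A , A∈K , f , f-homo , f-inj) v = f-inj (begin
    f (⟦_⟧ B φ v)    ≈⟨ ⟦⟧-homo f-homo φ v ⟩
    ⟦_⟧ A φ (f ∘ v)  ≈⟨ φ∈ A∈K (f ∘ v) ⟩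
    A.⊤              ≈⟨ F.⊤-homo ⟨
    f B.⊤            ∎)
    where
    module A = S4Algebra A
    module B = S4Algebra B
    module F = IsS4Homomorphism f-homo
    open ≈-Reasoning A.setoid

  Log-ℙ : Log K ⊆ Log (ℙ K)
  Log-ℙ {φ} φ∈ {B} (I , A , A∈K , f , f-homo , f-inj , _) v = f-inj λ i → begin
    f (⟦_⟧ B φ v) i            ≈⟨ ⟦⟧-homo f-homo φ v i ⟩
    ⟦_⟧ (∏ A) φ (f ∘ v) i      ≡⟨ coordinate φ (f ∘ v) i ⟩
    ⟦_⟧ (A i) φ (λ p → f (v p) i)  ≈⟨ φ∈ (A∈K i) _ ⟩
    A.⊤ i                      ≈⟨ F.⊤-homo i ⟨
    f B.⊤ i                    ∎
    where
    module A (i : I) = S4Algebra (A i)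
    module B = S4Algebra B
    module F = IsS4Homomorphism f-homo
    open module R {i} = ≈-Reasoning (A.setoid i)
    coordinate : ∀ φ w i → ⟦_⟧ (∏ A) φ w i ≡ ⟦_⟧ (A i) φ (λ p → w p i)
    coordinate (var p)  w i = ≡.refl
    coordinate ⊤ᶠ       w i = ≡.refl
    coordinate ⊥ᶠ       w i = ≡.refl
    coordinate (φ ∧ᶠ ψ) w i = ≡.cong₂ (A._∧_ i) (coordinate φ w i) (coordinate ψ w i)
    coordinate (φ ∨ᶠ ψ) w i = ≡.cong₂ (A._∨_ i) (coordinate φ w i) (coordinate ψ w i)
    coordinate (¬ᶠ φ)   w i = ≡.cong (A.¬_ i) (coordinate φ w i)
    coordinate (□ᶠ φ)   w i = ≡.cong (A.□ i) (coordinate φ w i)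

  ⊆ℍ𝕊ℙ : K ⊆ ℍ (𝕊 (ℙ K))
  ⊆ℍ𝕊ℙ {A} A∈K =
    A , (A , (Unit.⊤ , (λ _ → A) , (λ _ → A∈K) , diagonal) , id , id-isS4Homomorphism , id)
      , id , id-isS4Homomorphism , λ y → y , id
    where
    open S4Algebra A
    diagonal : A ≅ ∏ {I = Unit.⊤ {ℓ}} (λ _ → A)
    diagonal = (λ x _ → x)
      , record
        { isLatticeHomomorphism = record
          { isRelHomomorphism = record { cong = λ x≈y _ → x≈y }
          ; ∧-homo = λ _ _ _ → refl
          ; ∨-homo = λ _ _ _ → refl
          }
        ; ⊤-homo = λ _ → refl
        ; ⊥-homo = λ _ → refl
        ; ¬-homo = λ _ _ → refl
        ; □-homo = λ _ _ → refl
        }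
      , (λ x≈y → x≈y _) , λ y → y _ , λ x≈y _ → x≈y

-- Clausal normal forms

-- The operations of a Heyting algebra, without laws.  The intuitionistic
-- formulas form such a structure as well.
record RawHeyting (a : Level) : Set (lsuc a) where
  infixr 7 _∧_
  infixr 6 _∨_
  infixr 5 _⇨_
  field
    Carrier     : Set a
    _∧_ _∨_ _⇨_ : Carrier → Carrier → Carrier
    ⊤ ⊥         : Carrier

-- The underlying operations of a Heyting algebra.
rawHeyting : HeytingAlgebra c ℓ₁ ℓ₂ → RawHeyting c
rawHeyting H = record { HeytingAlgebra H }

-- Intuitionistic formulas under the connectives.
formulas : RawHeyting 0ℓ
formulas = record { Carrier = Int ; _∧_ = _∧ⁱ_ ; _∨_ = _∨ⁱ_ ; _⇨_ = _⇒ⁱ_ ; ⊤ = ⊤ⁱ ; ⊥ = ⊥ⁱ }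

module _ (D : RawHeyting a) where
  private module D = RawHeyting D

  -- A map that respects the bounded lattice operations of D.
  record IsLatticeMap (B : BooleanAlgebra c ℓ) (j : D.Carrier → BooleanAlgebra.Carrier B) :
      Set (a ⊔ ℓ) where
    open BooleanAlgebra B
    field
      ∧-homo : ∀ x y → j (x D.∧ y) ≈ j x ∧ j y
      ∨-homo : ∀ x y → j (x D.∨ y) ≈ j x ∨ j y
      ⊤-homo : j D.⊤ ≈ ⊤
      ⊥-homo : j D.⊥ ≈ ⊥

  -- A map that treats implication as the translation GMT does.
  record IsGMTMap (A : S4Algebra c ℓ) (j : D.Carrier → S4Algebra.Carrier A) :
      Set (a ⊔ ℓ) where
    open S4Algebra A
    field
      isLatticeMap : IsLatticeMap booleanAlgebra j
      ⇨-homo       : ∀ x y → j (x D.⇨ y) ≈ □ (¬ j x ∨ j y)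
    open IsLatticeMap isLatticeMap public

  -- A list of pairs (c , d) stands for the meet of the clauses ¬ c ∨ d.
  NF : Set a
  NF = List (D.Carrier × D.Carrier)

module NormalForm (D : RawHeyting a) where
  open RawHeyting D

  -- The single clause ¬ ⊤ ∨ d.
  unit : Carrier → NF D
  unit d = (⊤ , d) ∷ []

  -- disjoin c d xs stands for (c ∧ ¬ d) ∨ xs.
  disjoin : Carrier → Carrier → NF D → NF D
  disjoin c d []             = []
  disjoin c d ((x , y) ∷ xs) = (x , c ∨ y) ∷ (d ∧ x , y) ∷ disjoin c d xs

  infix 8 ∼_

  -- Complement, by distributivity.
  ∼_ : NF D → NF D
  ∼ []             = (⊤ , ⊥) ∷ []
  ∼ ((c , d) ∷ xs) = disjoin c d (∼ xs)

  -- Join, by De Morgan's law.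
  _⊔ⁿ_ : NF D → NF D → NF D
  xs ⊔ⁿ ys = ∼ (∼ xs ++ ∼ ys)

  -- The element of D whose image is □ of the meet of the clauses.
  interior : NF D → Carrier
  interior xs = foldr _∧_ ⊤ (map (λ (c , d) → c ⇨ d) xs)

  -- The normal form of φ when each letter p is assigned the normal form x p.
  nf : Modal → (ℕ → NF D) → NF D
  nf (var p)  x = x p
  nf ⊤ᶠ       x = []
  nf ⊥ᶠ       x = ∼ []
  nf (φ ∧ᶠ ψ) x = nf φ x ++ nf ψ x
  nf (φ ∨ᶠ ψ) x = nf φ x ⊔ⁿ nf ψ x
  nf (¬ᶠ φ)   x = ∼ nf φ x
  nf (□ᶠ φ)   x = unit (interior (nf φ x))

module Value (D : RawHeyting a) (B : BooleanAlgebra c ℓ)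
             (j : RawHeyting.Carrier D → BooleanAlgebra.Carrier B) where
  open BooleanAlgebra B

  -- The meet of clauses that a normal form stands for, with entries read through j.
  ⟪_⟫ : NF D → Carrier
  ⟪ xs ⟫ = foldr _∧_ ⊤ (map (λ (c , d) → ¬ j c ∨ j d) xs)

module ValueProperties {D : RawHeyting a} {B : BooleanAlgebra c ℓ}
                       {j : RawHeyting.Carrier D → BooleanAlgebra.Carrier B}
                       (j-map : IsLatticeMap D B j) where
  private module D = RawHeyting D
  open BooleanAlgebra B
  open BooleanOrder B
  open IsLatticeMap j-map
  open NormalForm D
  open Value D B j public
  open ≈-Reasoning setoid

  ⟪unit⟫ : ∀ d → ⟪ unit d ⟫ ≈ j d
  ⟪unit⟫ d = begin
    (¬ j D.⊤ ∨ j d) ∧ ⊤  ≈⟨ ∧-identityʳ _ ⟩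
    ¬ j D.⊤ ∨ j d        ≈⟨ ∨-congʳ (¬-cong ⊤-homo) ⟩
    ¬ ⊤ ∨ j d            ≈⟨ ∨-congʳ ¬⊤≈⊥ ⟩
    ⊥ ∨ j d              ≈⟨ ∨-identityˡ _ ⟩
    j d                  ∎

  ⟪++⟫ : ∀ xs ys → ⟪ xs ++ ys ⟫ ≈ ⟪ xs ⟫ ∧ ⟪ ys ⟫
  ⟪++⟫ []       ys = sym (∧-identityˡ _)
  ⟪++⟫ (x ∷ xs) ys = trans (∧-congˡ (⟪++⟫ xs ys)) (sym (∧-assoc _ _ _))

  ⟪disjoin⟫ : ∀ c d xs → ⟪ disjoin c d xs ⟫ ≈ (j c ∧ ¬ j d) ∨ ⟪ xs ⟫
  ⟪disjoin⟫ c d []             = sym (∨-zeroʳ _)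
  ⟪disjoin⟫ c d ((x , y) ∷ xs) = begin
    (¬ j x ∨ j (c D.∨ y)) ∧ (¬ j (d D.∧ x) ∨ j y) ∧ ⟪ disjoin c d xs ⟫
      ≈⟨ ∧-assoc _ _ _ ⟨
    ((¬ j x ∨ j (c D.∨ y)) ∧ (¬ j (d D.∧ x) ∨ j y)) ∧ ⟪ disjoin c d xs ⟫
      ≈⟨ ∧-cong (∧-cong left right) (⟪disjoin⟫ c d xs) ⟩
    ((j c ∨ (¬ j x ∨ j y)) ∧ (¬ j d ∨ (¬ j x ∨ j y))) ∧ ((j c ∧ ¬ j d) ∨ ⟪ xs ⟫)
      ≈⟨ ∧-congʳ (∨-distribʳ-∧ _ _ _) ⟨
    ((j c ∧ ¬ j d) ∨ (¬ j x ∨ j y)) ∧ ((j c ∧ ¬ j d) ∨ ⟪ xs ⟫)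
      ≈⟨ ∨-distribˡ-∧ _ _ _ ⟨
    (j c ∧ ¬ j d) ∨ (¬ j x ∨ j y) ∧ ⟪ xs ⟫
      ∎
    where
    left : ¬ j x ∨ j (c D.∨ y) ≈ j c ∨ (¬ j x ∨ j y)
    left = begin
      ¬ j x ∨ j (c D.∨ y)    ≈⟨ ∨-congˡ (∨-homo c y) ⟩
      ¬ j x ∨ (j c ∨ j y)    ≈⟨ ∨-assoc _ _ _ ⟨
      (¬ j x ∨ j c) ∨ j y    ≈⟨ ∨-congʳ (∨-comm _ _) ⟩
      (j c ∨ ¬ j x) ∨ j y    ≈⟨ ∨-assoc _ _ _ ⟩
      j c ∨ (¬ j x ∨ j y)    ∎
    right : ¬ j (d D.∧ x) ∨ j y ≈ ¬ j d ∨ (¬ j x ∨ j y)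
    right = begin
      ¬ j (d D.∧ x) ∨ j y    ≈⟨ ∨-congʳ (¬-cong (∧-homo d x)) ⟩
      ¬ (j d ∧ j x) ∨ j y    ≈⟨ ∨-congʳ (deMorgan₁ _ _) ⟩
      (¬ j d ∨ ¬ j x) ∨ j y  ≈⟨ ∨-assoc _ _ _ ⟩
      ¬ j d ∨ (¬ j x ∨ j y)  ∎

  ⟪∼⟫ : ∀ xs → ⟪ ∼ xs ⟫ ≈ ¬ ⟪ xs ⟫
  ⟪∼⟫ [] = begin
    ⟪ unit D.⊥ ⟫  ≈⟨ ⟪unit⟫ D.⊥ ⟩
    j D.⊥         ≈⟨ ⊥-homo ⟩
    ⊥             ≈⟨ ¬⊤≈⊥ ⟨
    ¬ ⊤           ∎
  ⟪∼⟫ ((c , d) ∷ xs) = begin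
    ⟪ disjoin c d (∼ xs) ⟫          ≈⟨ ⟪disjoin⟫ c d (∼ xs) ⟩
    (j c ∧ ¬ j d) ∨ ⟪ ∼ xs ⟫        ≈⟨ ∨-cong (∧-congʳ (sym (¬-involutive _))) (⟪∼⟫ xs) ⟩
    (¬ ¬ j c ∧ ¬ j d) ∨ ¬ ⟪ xs ⟫    ≈⟨ ∨-congʳ (deMorgan₂ _ _) ⟨
    ¬ (¬ j c ∨ j d) ∨ ¬ ⟪ xs ⟫      ≈⟨ deMorgan₁ _ _ ⟨
    ¬ ((¬ j c ∨ j d) ∧ ⟪ xs ⟫)      ∎

  ⟪⊔⟫ : ∀ xs ys → ⟪ xs ⊔ⁿ ys ⟫ ≈ ⟪ xs ⟫ ∨ ⟪ ys ⟫
  ⟪⊔⟫ xs ys = begin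
    ⟪ ∼ (∼ xs ++ ∼ ys) ⟫      ≈⟨ ⟪∼⟫ (∼ xs ++ ∼ ys) ⟩
    ¬ ⟪ ∼ xs ++ ∼ ys ⟫        ≈⟨ ¬-cong (⟪++⟫ (∼ xs) (∼ ys)) ⟩
    ¬ (⟪ ∼ xs ⟫ ∧ ⟪ ∼ ys ⟫)   ≈⟨ deMorgan₁ _ _ ⟩
    ¬ ⟪ ∼ xs ⟫ ∨ ¬ ⟪ ∼ ys ⟫   ≈⟨ ∨-cong (double xs) (double ys) ⟩
    ⟪ xs ⟫ ∨ ⟪ ys ⟫           ∎
    where
    double : ∀ zs → ¬ ⟪ ∼ zs ⟫ ≈ ⟪ zs ⟫
    double zs = trans (¬-cong (⟪∼⟫ zs)) (¬-involutive _)

-- Truth of a normal form depends only on the order between the values of its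
-- entries.
module _ {D : RawHeyting a} {B₁ : BooleanAlgebra c ℓ₁} {B₂ : BooleanAlgebra k ℓ₂}
         (j₁ : RawHeyting.Carrier D → BooleanAlgebra.Carrier B₁)
         (j₂ : RawHeyting.Carrier D → BooleanAlgebra.Carrier B₂) where
  private
    module B₁ = BooleanAlgebra B₁
    module B₂ = BooleanAlgebra B₂
    module O₁ = BooleanOrder B₁
    module O₂ = BooleanOrder B₂
    module V₁ = Value D B₁ j₁
    module V₂ = Value D B₂ j₂

  -- Inequalities between values of j₁ hold between values of j₂ as well.
  OrderTransfer : Set _
  OrderTransfer = ∀ {c d} → j₁ c O₁.≤ j₁ d → j₂ c O₂.≤ j₂ d

  ⟪⟫-transfer : OrderTransfer → ∀ xs → V₁.⟪ xs ⟫ B₁.≈ B₁.⊤ → V₂.⟪ xs ⟫ B₂.≈ B₂.⊤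
  ⟪⟫-transfer mono []             _ = B₂.refl
  ⟪⟫-transfer mono ((c , d) ∷ xs) p = B₂.trans
    (B₂.∧-cong (O₂.≤⇒¬∨≈⊤ (mono (O₁.¬∨≈⊤⇒≤ (above (O₁.x∧y≤x _ _)))))
               (⟪⟫-transfer mono xs (above (O₁.x∧y≤y _ _))))
    (O₂.∧-identityˡ _)
    where
    above : ∀ {x} → V₁.⟪ (c , d) ∷ xs ⟫ O₁.≤ x → x B₁.≈ B₁.⊤
    above q = O₁.⊤≤⇒≈⊤ (O₁.≤-trans (O₁.≤-reflexive (B₁.sym p)) q)

module GMTMapProperties {D : RawHeyting a} {A : S4Algebra c ℓ}
                        {j : RawHeyting.Carrier D → S4Algebra.Carrier A}
                        (j-map : IsGMTMap D A j) where
  open S4Algebra A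
  open BooleanOrder booleanAlgebra
  open IsGMTMap j-map
  open NormalForm D
  open ValueProperties isLatticeMap public

  □⟪⟫ : ∀ xs → □ ⟪ xs ⟫ ≈ j (interior xs)
  □⟪⟫ []             = trans □-⊤ (sym ⊤-homo)
  □⟪⟫ ((c , d) ∷ xs) = begin
    □ ((¬ j c ∨ j d) ∧ ⟪ xs ⟫)             ≈⟨ □-∧ _ _ ⟩
    □ (¬ j c ∨ j d) ∧ □ ⟪ xs ⟫             ≈⟨ ∧-cong (sym (⇨-homo c d)) (□⟪⟫ xs) ⟩
    j (c ⇨ d) ∧ j (interior xs)            ≈⟨ ∧-homo _ _ ⟨
    j ((c ⇨ d) D.∧ interior xs)            ∎
    where
    open ≈-Reasoning setoid
    module D = RawHeyting D
    open D using (_⇨_)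

  -- Modal combinations of normal forms are normal forms, and the computation of
  -- the latter does not depend on j.
  nf-value : ∀ φ x {v} → (∀ p → v p ≈ ⟪ x p ⟫) → ⟦_⟧ A φ v ≈ ⟪ nf φ x ⟫
  nf-value (var p)  x v≈x = v≈x p
  nf-value ⊤ᶠ       x v≈x = refl
  nf-value ⊥ᶠ       x v≈x = sym (trans (⟪∼⟫ []) ¬⊤≈⊥)
  nf-value (φ ∧ᶠ ψ) x v≈x =
    trans (∧-cong (nf-value φ x v≈x) (nf-value ψ x v≈x)) (sym (⟪++⟫ (nf φ x) (nf ψ x)))
  nf-value (φ ∨ᶠ ψ) x v≈x =
    trans (∨-cong (nf-value φ x v≈x) (nf-value ψ x v≈x)) (sym (⟪⊔⟫ (nf φ x) (nf ψ x)))
  nf-value (¬ᶠ φ)   x v≈x = trans (¬-cong (nf-value φ x v≈x)) (sym (⟪∼⟫ (nf φ x)))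
  nf-value (□ᶠ φ)   x v≈x =
    trans (□-cong (nf-value φ x v≈x)) (trans (□⟪⟫ (nf φ x)) (sym (⟪unit⟫ _)))

-- Hence truth of modal combinations of normal forms transfers as well.
module _ {D : RawHeyting a} {A₁ : S4Algebra c ℓ₁} {A₂ : S4Algebra k ℓ₂}
         {j₁ : RawHeyting.Carrier D → S4Algebra.Carrier A₁}
         {j₂ : RawHeyting.Carrier D → S4Algebra.Carrier A₂}
         (j₁-map : IsGMTMap D A₁ j₁) (j₂-map : IsGMTMap D A₂ j₂) where
  private
    module A₁ = S4Algebra A₁
    module A₂ = S4Algebra A₂
    module M₁ = GMTMapProperties j₁-map
    module M₂ = GMTMapProperties j₂-map

  truth-transfer : OrderTransfer {D = D} {A₁.booleanAlgebra} {A₂.booleanAlgebra} j₁ j₂ →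
    ∀ φ x {v₁ v₂} → (∀ p → v₁ p A₁.≈ M₁.⟪ x p ⟫) → (∀ p → v₂ p A₂.≈ M₂.⟪ x p ⟫) →
    ⟦_⟧ A₁ φ v₁ A₁.≈ A₁.⊤ → ⟦_⟧ A₂ φ v₂ A₂.≈ A₂.⊤
  truth-transfer mono φ x v₁≈x v₂≈x true₁ = A₂.trans (M₂.nf-value φ x v₂≈x)
    (⟪⟫-transfer {D = D} {A₁.booleanAlgebra} {A₂.booleanAlgebra} j₁ j₂ mono (NormalForm.nf D φ x)
      (A₁.trans (A₁.sym (M₁.nf-value φ x v₁≈x)) true₁))

-- Envelope operators

T⇒≤ : ∀ {x y} → (T x → T y) → x ≡ x Bool.∧ y
T⇒≤ {false}         _ = ≡.refl
T⇒≤ {true}  {true}  _ = ≡.refl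
T⇒≤ {true}  {false} f = contradiction (f _) id

≤⇒T : ∀ {x y} → x ≡ x Bool.∧ y → T x → T y
≤⇒T {true} {true} _ _ = _

T-∨⁺ : ∀ {x y} → T x ⊎ T y → T (x Bool.∨ y)
T-∨⁺ {true}  _        = _
T-∨⁺ {false} (inj₂ q) = q

module Envelope (H : HeytingAlgebra c ℓ₁ ℓ₂) where
  private
    module H = HeytingAlgebra H
    module E = BooleanAlgebra (envelope H)
    D = rawHeyting H
  open BooleanOrder (envelope H)
  open NormalForm D

  ι-mono : ∀ {x y} → x H.≤ y → ι H x ≤ ι H y
  ι-mono x≤y F = T⇒≤ (PrimeFilter.upward F x≤y)

  ι-cong : ∀ {x y} → x H.≈ y → ι H x E.≈ ι H y
  ι-cong {x} {y} x≈y =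
    antisym {ι H x} {ι H y} (ι-mono (H.reflexive x≈y)) (ι-mono (H.reflexive (H.Eq.sym x≈y)))

  ι-isLatticeMap : IsLatticeMap D (envelope H) (ι H)
  ι-isLatticeMap = record
    { ∧-homo = λ x y → antisym {ι H (x H.∧ y)} {ι H x E.∧ ι H y}
        (∧-greatest {ι H (x H.∧ y)} {ι H x} {ι H y} (ι-mono (H.x∧y≤x x y)) (ι-mono (H.x∧y≤y x y)))
        (λ F → T⇒≤ λ t → PrimeFilter.∧-in F
          (≤⇒T (x∧y≤x (ι H x) (ι H y) F) t) (≤⇒T (x∧y≤y (ι H x) (ι H y) F) t))
    ; ∨-homo = λ x y → antisym {ι H (x H.∨ y)} {ι H x E.∨ ι H y}
        (λ F → T⇒≤ λ t → T-∨⁺ (PrimeFilter.prime F t))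
        (∨-least {ι H x} {ι H y} {ι H (x H.∨ y)} (ι-mono (H.x≤x∨y x y)) (ι-mono (H.y≤x∨y x y)))
    ; ⊤-homo = ⊤≤⇒≈⊤ {ι H H.⊤} λ F → T⇒≤ λ _ → PrimeFilter.⊤-in F
    ; ⊥-homo = antisym {ι H H.⊥} {E.⊥}
        (λ F → T⇒≤ λ t → contradiction t (PrimeFilter.⊥-out F))
        (λ F → ≡.refl)
    }

  open ValueProperties ι-isLatticeMap
  private module ι = IsLatticeMap ι-isLatticeMap

  private
    Term : BooleanAlgebra.Carrier (𝒫 (PrimeFilter H)) → Set _
    Term = Generated (𝒫 (PrimeFilter H)) (stone H)

  -- The normal form of an element of the envelope depends on how the element is
  -- generated; only its value does not.
  normalForm : ∀ {e} → Term e → NF D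
  normalForm (gen x)     = unit x
  normalForm ⊤-gen       = []
  normalForm ⊥-gen       = ∼ []
  normalForm (∧-gen g h) = normalForm g ++ normalForm h
  normalForm (∨-gen g h) = normalForm g ⊔ⁿ normalForm h
  normalForm (¬-gen g)   = ∼ normalForm g

  ⟪normalForm⟫ : ∀ {e} (g : Term e) → ⟪ normalForm g ⟫ E.≈ (e , g)
  ⟪normalForm⟫ (gen x) = ⟪unit⟫ x
  ⟪normalForm⟫ ⊤-gen   = E.refl {E.⊤}
  ⟪normalForm⟫ ⊥-gen   = E.trans {⟪ ∼ [] ⟫} {E.¬ E.⊤} {E.⊥} (⟪∼⟫ []) (λ _ → ≡.refl)
  ⟪normalForm⟫ (∧-gen {a} {b} g h) =
    E.trans {⟪ xs ++ ys ⟫} {⟪ xs ⟫ E.∧ ⟪ ys ⟫} {(a , g) E.∧ (b , h)} (⟪++⟫ xs ys)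
      (E.∧-cong {⟪ xs ⟫} {a , g} {⟪ ys ⟫} {b , h} (⟪normalForm⟫ g) (⟪normalForm⟫ h))
    where xs = normalForm g ; ys = normalForm h
  ⟪normalForm⟫ (∨-gen {a} {b} g h) =
    E.trans {⟪ xs ⊔ⁿ ys ⟫} {⟪ xs ⟫ E.∨ ⟪ ys ⟫} {(a , g) E.∨ (b , h)} (⟪⊔⟫ xs ys)
      (E.∨-cong {⟪ xs ⟫} {a , g} {⟪ ys ⟫} {b , h} (⟪normalForm⟫ g) (⟪normalForm⟫ h))
    where xs = normalForm g ; ys = normalForm h
  ⟪normalForm⟫ (¬-gen {a} g) =
    E.trans {⟪ ∼ xs ⟫} {E.¬ ⟪ xs ⟫} {E.¬ (a , g)} (⟪∼⟫ xs)
      (E.¬-cong {⟪ xs ⟫} {a , g} (⟪normalForm⟫ g))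
    where xs = normalForm g

  -- The equation for □ on a single clause says that ι respects implication.
  module _ (O : EnvelopeOperator H) where
    open EnvelopeOperator O

    ι-isGMTMap : IsGMTMap D algebra (ι H)
    ι-isGMTMap = record
      { isLatticeMap = ι-isLatticeMap
      ; ⇨-homo = λ x y → begin
          ι H (x H.⇨ y)                         ≈⟨ ι-cong ∧-⊤ ⟨
          ι H ((x H.⇨ y) H.∧ H.⊤)               ≈⟨ □-clauses ((x , y) ∷ []) ⟨
          □ ((E.¬ ι H x E.∨ ι H y) E.∧ E.⊤)     ≈⟨ □-cong (∧-identityʳ (E.¬ ι H x E.∨ ι H y)) ⟩
          □ (E.¬ ι H x E.∨ ι H y)               ∎
      }
      where
      open ≈-Reasoning E.setoid
      open IsS4Operator isS4Operator
      ∧-⊤ : ∀ {x} → x H.∧ H.⊤ H.≈ x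
      ∧-⊤ = H.antisym (H.x∧y≤x _ _) (H.∧-greatest H.refl (H.maximum _))

  -- If the Stone map is an order embedding, then interior xs is the largest x
  -- with ι x below the value of xs, and so □ is well defined.
  module _ (reflects : ∀ {x y} → ι H x ≤ ι H y → x H.≤ y) where

    -- The right adjoint of ι.  Up to equality it does not depend on how e is generated.
    core : E.Carrier → H.Carrier
    core (_ , g) = interior (normalForm g)

    ≤-interior⁺ : ∀ {x} xs → ι H x ≤ ⟪ xs ⟫ → x H.≤ interior xs
    ≤-interior⁺ {x} []             _ = H.maximum x
    ≤-interior⁺ {x} ((c , d) ∷ xs) p = H.∧-greatest
      (H.transpose-⇨ (reflects (begin
        ι H (x H.∧ c)       ≈⟨ ι.∧-homo x c ⟩
        ι H x E.∧ ι H c     ≤⟨ transpose-∧ {ι H x} {ι H c} {ι H d} (begin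
          ι H x                    ≤⟨ p ⟩
          ⟪ (c , d) ∷ xs ⟫         ≤⟨ x∧y≤x (E.¬ ι H c E.∨ ι H d) ⟪ xs ⟫ ⟩
          E.¬ ι H c E.∨ ι H d      ∎) ⟩
        ι H d               ∎)))
      (≤-interior⁺ xs (begin
        ι H x               ≤⟨ p ⟩
        ⟪ (c , d) ∷ xs ⟫    ≤⟨ x∧y≤y (E.¬ ι H c E.∨ ι H d) ⟪ xs ⟫ ⟩
        ⟪ xs ⟫              ∎))
      where open ≤-Reasoning poset

    ι-interior≤ : ∀ xs → ι H (interior xs) ≤ ⟪ xs ⟫
    ι-interior≤ []             = ≤-⊤ {ι H H.⊤}
    ι-interior≤ ((c , d) ∷ xs) =
      ∧-greatest {ι H (interior ((c , d) ∷ xs))} {E.¬ ι H c E.∨ ι H d} {⟪ xs ⟫}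
        (transpose-∨ {ι H (interior ((c , d) ∷ xs))} {ι H c} {ι H d} (begin
          ι H (interior ((c , d) ∷ xs)) E.∧ ι H c      ≈⟨ ι.∧-homo (interior ((c , d) ∷ xs)) c ⟨
          ι H (interior ((c , d) ∷ xs) H.∧ c)
            ≤⟨ ι-mono (H.transpose-∧ (H.x∧y≤x (c H.⇨ d) (interior xs))) ⟩
          ι H d                                        ∎))
        (begin
          ι H (interior ((c , d) ∷ xs))    ≤⟨ ι-mono (H.x∧y≤y (c H.⇨ d) (interior xs)) ⟩
          ι H (interior xs)                ≤⟨ ι-interior≤ xs ⟩
          ⟪ xs ⟫                           ∎)
      where open ≤-Reasoning poset

    ≤-core : ∀ {x} e → ι H x ≤ e → x H.≤ core e
    ≤-core {x} e@(_ , g) p = ≤-interior⁺ (normalForm g)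
      (≤-trans {ι H x} {e} {⟪ normalForm g ⟫} p
        (≤-reflexive {e} {⟪ normalForm g ⟫} (E.sym {⟪ normalForm g ⟫} {e} (⟪normalForm⟫ g))))

    ι-core≤ : ∀ e → ι H (core e) ≤ e
    ι-core≤ e@(_ , g) = ≤-trans {ι H (core e)} {⟪ normalForm g ⟫} {e} (ι-interior≤ (normalForm g))
      (≤-reflexive {⟪ normalForm g ⟫} {e} (⟪normalForm⟫ g))

    core-mono : ∀ e f → e ≤ f → core e H.≤ core f
    core-mono e f p = ≤-core f (≤-trans {ι H (core e)} {e} {f} (ι-core≤ e) p)

    envelopeOperator : EnvelopeOperator H
    envelopeOperator = record
      { □            = λ e → ι H (core e)
      ; isS4Operator = record
        { □-cong = λ {e} {f} p → ι-cong (H.antisym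
            (core-mono e f (≤-reflexive {e} {f} p))
            (core-mono f e (≤-reflexive {f} {e} (E.sym {e} {f} p))))
        ; □-⊤    = ⊤≤⇒≈⊤ {ι H (core E.⊤)} (begin
            E.⊤              ≈⟨ ι.⊤-homo ⟨
            ι H H.⊤          ≤⟨ ι-mono (≤-core E.⊤ (≤-⊤ {ι H H.⊤})) ⟩
            ι H (core E.⊤)   ∎)
        ; □-∧    = λ e f → antisym {ι H (core (e E.∧ f))} {ι H (core e) E.∧ ι H (core f)}
            (∧-greatest {ι H (core (e E.∧ f))} {ι H (core e)} {ι H (core f)}
              (ι-mono (core-mono (e E.∧ f) e (x∧y≤x e f)))
              (ι-mono (core-mono (e E.∧ f) f (x∧y≤y e f))))
            (begin
              ι H (core e) E.∧ ι H (core f)   ≈⟨ ι.∧-homo (core e) (core f) ⟨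
              ι H (core e H.∧ core f)         ≤⟨ ι-mono (≤-core (e E.∧ f)
                (∧-greatest {ι H (core e H.∧ core f)} {e} {f}
                  (begin
                    ι H (core e H.∧ core f)   ≤⟨ ι-mono (H.x∧y≤x (core e) (core f)) ⟩
                    ι H (core e)              ≤⟨ ι-core≤ e ⟩
                    e                         ∎)
                  (begin
                    ι H (core e H.∧ core f)   ≤⟨ ι-mono (H.x∧y≤y (core e) (core f)) ⟩
                    ι H (core f)              ≤⟨ ι-core≤ f ⟩
                    f                         ∎))) ⟩
              ι H (core (e E.∧ f))            ∎)
        ; □-T    = ι-core≤
        ; □-4    = λ e → ι-mono (≤-core (ι H (core e)) (≤-refl {ι H (core e)}))
        }
      ; □-clauses    = λ cds → ι-cong (H.antisym
          (≤-interior⁺ cds (ι-core≤ (clauses H cds)))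
          (≤-core (clauses H cds) (ι-interior≤ cds)))
      }
      where open ≤-Reasoning poset

-- Prime filters of countable Heyting algebras

module CountablePrimeFilters (em : ExcludedMiddle ℓ) (H : HeytingAlgebra ℓ ℓ ℓ)
  (enum : ℕ → HeytingAlgebra.Carrier H)
  (enum-surjective : ∀ x → ∃[ n ] HeytingAlgebra._≈_ H (enum n) x) where

  open HeytingAlgebra H
  open HeytingProperties H using (∧-distribˡ-∨-≤)

  -- A prime filter containing x but not y.
  module Separation {x y : Carrier} (x≰y : Not (x ≤ y)) where

    -- z ∧ w, or z if z ∧ w is below y.
    extend : ∀ z w → Dec (z ∧ w ≤ y) → Carrier
    extend z w (yes _) = z
    extend z w (no  _) = z ∧ w

    -- The n-th generator of the filter: at each step the meet with the next element
    -- of H is taken, unless that meet is below y.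
    chain : ℕ → Carrier
    chain zero    = x
    chain (suc n) = extend (chain n) (enum n) em

    extend≰ : ∀ {z w} d → Not (z ≤ y) → Not (extend z w d ≤ y)
    extend≰ (yes _)     z≰y = z≰y
    extend≰ (no  z∧w≰y) _   = z∧w≰y

    extend≤ : ∀ {z w} d → extend z w d ≤ z
    extend≤ (yes _) = refl
    extend≤ (no  _) = x∧y≤x _ _

    extend-decides : ∀ {z w} d → extend z w d ∧ w ≤ y ⊎ extend z w d ≤ w
    extend-decides (yes z∧w≤y) = inj₁ z∧w≤y
    extend-decides (no  _)     = inj₂ (x∧y≤y _ _)

    chain≰ : ∀ n → Not (chain n ≤ y)
    chain≰ zero    = x≰y
    chain≰ (suc n) = extend≰ {chain n} em (chain≰ n)

    chain-antitone′ : ∀ {m n} → m ≤′ n → chain n ≤ chain m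
    chain-antitone′ ≤′-refl       = refl
    chain-antitone′ (≤′-step m≤n) = trans (extend≤ em) (chain-antitone′ m≤n)

    chain-antitone : ∀ {m n} → m ℕ.≤ n → chain n ≤ chain m
    chain-antitone = chain-antitone′ ∘ ℕ.≤⇒≤′

    -- Membership in the filter generated by the chain.
    In : Carrier → Set ℓ
    In z = ∃[ n ] chain n ≤ z

    -- Every element of H has its turn in the enumeration; afterwards it is either in
    -- the filter or incompatible with it modulo y.
    decided : ∀ z → (∃[ n ] chain n ∧ z ≤ y) ⊎ In z
    decided z with enum-surjective z
    ... | n , e with extend-decides {chain n} {enum n} em
    ...   | inj₁ p = inj₁ (suc n , trans
      (∧-greatest (x∧y≤x _ _) (trans (x∧y≤y _ _) (reflexive (Eq.sym e)))) p)
    ...   | inj₂ p = inj₂ (suc n , trans p (reflexive e))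

    In-∧ : ∀ {z w} → In z → In w → In (z ∧ w)
    In-∧ (m , p) (n , q) = m ℕ.+ n , ∧-greatest
      (trans (chain-antitone (ℕ.m≤m+n m n)) p)
      (trans (chain-antitone (ℕ.m≤n+m n m)) q)

    In-prime : ∀ {z w} → In (z ∨ w) → In z ⊎ In w
    In-prime {z} {w} (k , p) with decided z | decided w
    ... | inj₂ z∈       | _             = inj₁ z∈
    ... | inj₁ _        | inj₂ w∈       = inj₂ w∈
    ... | inj₁ (m , q)  | inj₁ (n , r)  = contradiction
      (trans (∧-greatest refl (trans (chain-antitone k≤i) p))
        (trans (∧-distribˡ-∨-≤ _ _ _)
          (∨-least (trans (below (chain-antitone m≤i)) q) (trans (below (chain-antitone n≤i)) r))))
      (chain≰ i)
      where
      -- A stage beyond k, m and n: there the chain is below z ∨ w, while its meets with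
      -- z and with w are below y.
      i = k ℕ.+ (m ℕ.+ n)
      k≤i = ℕ.m≤m+n k (m ℕ.+ n)
      m≤i = ℕ.≤-trans (ℕ.m≤m+n m n) (ℕ.m≤n+m (m ℕ.+ n) k)
      n≤i = ℕ.≤-trans (ℕ.m≤n+m n m) (ℕ.m≤n+m (m ℕ.+ n) k)
      below : ∀ {u u′ v} → u ≤ u′ → u ∧ v ≤ u′ ∧ v
      below u≤u′ = ∧-greatest (trans (x∧y≤x _ _) u≤u′) (x∧y≤y _ _)

    filter : PrimeFilter H
    filter = record
      { χ      = λ z → ⌊ em {In z} ⌋
      ; upward = λ z≤w t → let n , p = toWitness t in fromWitness (n , trans p z≤w)
      ; ⊤-in   = fromWitness (0 , maximum _)
      ; ∧-in   = λ s t → fromWitness (In-∧ (toWitness s) (toWitness t))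
      ; ⊥-out  = λ t → let n , p = toWitness t in chain≰ n (trans p (minimum _))
      ; prime  = λ {z} {w} t → separate (In-prime {z} {w} (toWitness t))
      }
      where
      separate : ∀ {z w} → In z ⊎ In w → T ⌊ em {In z} ⌋ ⊎ T ⌊ em {In w} ⌋
      separate (inj₁ p) = inj₁ (fromWitness p)
      separate (inj₂ q) = inj₂ (fromWitness q)

    open PrimeFilter filter using (Member)

    x-in : Member x
    x-in = fromWitness (0 , refl)

    y-out : Not (Member y)
    y-out t = let n , p = toWitness t in chain≰ n p

  ι-reflects-≤ : ∀ {x y} → BooleanOrder._≤_ (envelope H) (ι H x) (ι H y) → x ≤ y
  ι-reflects-≤ {x} {y} p with em {x ≤ y}
  ... | yes x≤y = x≤y
  ... | no  x≰y = contradiction (≤⇒T (p S.filter) S.x-in) S.y-out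
    where module S = Separation x≰y

-- Codings

-- The successor of a pair in the enumeration of ℕ × ℕ by diagonals.
next : ℕ × ℕ → ℕ × ℕ
next (i , zero)  = 0 , suc i
next (i , suc j) = suc i , j

unpair : ℕ → ℕ × ℕ
unpair zero    = 0 , 0
unpair (suc n) = next (unpair n)

unpair-surjective : ∀ i j → ∃[ n ] unpair n ≡ (i , j)
unpair-surjective i j = onDiagonal (i ℕ.+ j) i j ≡.refl
  where
  -- s is the sum of the coordinates; along a diagonal, i increases.
  onDiagonal : ∀ s i j → i ℕ.+ j ≡ s → ∃[ n ] unpair n ≡ (i , j)
  onDiagonal s       zero    zero    _ = 0 , ≡.refl
  onDiagonal (suc s) zero    (suc j) e
    with n , p ← onDiagonal s j zero (≡.trans (ℕ.+-identityʳ j) (ℕ.suc-injective e)) =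
    suc n , ≡.cong next p
  onDiagonal s       (suc i) j       e
    with n , p ← onDiagonal s i (suc j) (≡.trans (ℕ.+-suc i j) e) =
    suc n , ≡.cong next p

-- A code of (i , j).
pair : ℕ → ℕ → ℕ
pair i j = proj₁ (unpair-surjective i j)

unpair-pair : ∀ i j → unpair (pair i j) ≡ (i , j)
unpair-pair i j = proj₂ (unpair-surjective i j)

-- The formula with connective numbered by the first coordinate and with immediate
-- subformulas f n, or f i and f j where n codes (i , j).  At 0 it is f n itself, so
-- that codes persist when the height bound grows.
node : (ℕ → Modal) → ℕ × ℕ → Modal
node f (0 , n) = f n
node f (1 , n) = var n
node f (2 , _) = ⊥ᶠ
node f (3 , n) = f (proj₁ (unpair n)) ∧ᶠ f (proj₂ (unpair n))
node f (4 , n) = f (proj₁ (unpair n)) ∨ᶠ f (proj₂ (unpair n))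
node f (5 , n) = ¬ᶠ f n
node f (_ , n) = □ᶠ f n

-- The formulas decode d n are built in at most d applications of node, starting
-- from ⊤ᶠ.
decode : ℕ → ℕ → Modal
decode zero    _ = ⊤ᶠ
decode (suc d) n = node (decode d) (unpair n)

-- φ occurs among the decode d n.
Coded : ℕ → Modal → Set
Coded d φ = ∃[ n ] decode d n ≡ φ

coded-node : ∀ d i n → Coded (suc d) (node (decode d) (i , n))
coded-node d i n = pair i n , ≡.cong (node (decode d)) (unpair-pair i n)

coded-+ : ∀ k {d φ} → Coded d φ → Coded (k ℕ.+ d) φ
coded-+ zero    p = p
coded-+ (suc k) {d} p with n , e ← coded-+ k p =
  map₂ (λ e′ → ≡.trans e′ e) (coded-node (k ℕ.+ d) 0 n)

coded-binary : ∀ (_⊗_ : Modal → Modal → Modal) i →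
  (∀ d n → node (decode d) (i , n) ≡ (decode d (proj₁ (unpair n)) ⊗ decode d (proj₂ (unpair n)))) →
  ∀ {φ ψ} → ∃[ d ] Coded d φ → ∃[ d ] Coded d ψ → ∃[ d ] Coded d (φ ⊗ ψ)
coded-binary _⊗_ i node-⊗ {φ} {ψ} (d , p) (e , q)
  with m , p′ ← coded-+ e p
     | n , q′ ← ≡.subst (λ h → Coded h ψ) (ℕ.+-comm d e) (coded-+ d q) =
  suc (e ℕ.+ d) , proj₁ coded , ≡.trans (proj₂ coded)
    (≡.trans (node-⊗ (e ℕ.+ d) (pair m n))
      (≡.trans
        (≡.cong (λ (i , j) → decode (e ℕ.+ d) i ⊗ decode (e ℕ.+ d) j) (unpair-pair m n))
        (≡.cong₂ _⊗_ p′ q′)))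
  where coded = coded-node (e ℕ.+ d) i (pair m n)

coded : ∀ φ → ∃[ d ] Coded d φ
coded (var p)  = 1 , coded-node 0 1 p
coded ⊤ᶠ       = 0 , 0 , ≡.refl
coded ⊥ᶠ       = 1 , coded-node 0 2 0
coded (φ ∧ᶠ ψ) = coded-binary _∧ᶠ_ 3 (λ _ _ → ≡.refl) (coded φ) (coded ψ)
coded (φ ∨ᶠ ψ) = coded-binary _∨ᶠ_ 4 (λ _ _ → ≡.refl) (coded φ) (coded ψ)
coded (¬ᶠ φ)   with d , n , ≡.refl ← coded φ = suc d , coded-node d 5 n
coded (□ᶠ φ)   with d , n , ≡.refl ← coded φ = suc d , coded-node d 6 n

-- An enumeration of all modal formulas.
formula : ℕ → Modal
formula n = decode (proj₁ (unpair n)) (proj₂ (unpair n))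

formula-surjective : ∀ φ → ∃[ n ] formula n ≡ φ
formula-surjective φ with d , n , p ← coded φ =
  pair d n , ≡.trans (≡.cong (λ (d , n) → decode d n) (unpair-pair d n)) p

-- A countable family x of normal forms over D as a family of formulas over a
-- single valuation of the letters in D: the letter pair p n stands for the n-th
-- entry of x p.
module _ {D : RawHeyting a} where
  open RawHeyting D

  -- The entries of a list of pairs, read from left to right, and ⊤ past the end.
  entry : NF D → ℕ → Carrier
  entry []             _             = ⊤
  entry ((c , _) ∷ _)  zero          = c
  entry ((_ , d) ∷ _)  (suc zero)    = d
  entry (_       ∷ xs) (suc (suc n)) = entry xs n

  -- The common valuation.
  entries : (ℕ → NF D) → ℕ → Carrier
  entries x n = entry (x (proj₁ (unpair n))) (proj₂ (unpair n))

  -- The meet of clauses as a formula, in which the letter for the n-th entry is r n.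
  clausal : NF D → (ℕ → ℕ) → Modal
  clausal []       r = ⊤ᶠ
  clausal (_ ∷ xs) r = (var (r 0) ⇒ᶠ var (r 1)) ∧ᶠ clausal xs (r ∘ suc ∘ suc)

  module _ (A : S4Algebra c ℓ) (j : Carrier → S4Algebra.Carrier A) where
    open S4Algebra A renaming (_∧_ to _∧ᴬ_; _∨_ to _∨ᴬ_; ⊤ to ⊤ᴬ; Carrier to |A|)
    open Value D booleanAlgebra j

    clausal-value : ∀ xs r {v} → (∀ n → v (r n) ≈ j (entry xs n)) →
      ⟦_⟧ A (clausal xs r) v ≈ ⟪ xs ⟫
    clausal-value []       r v≈ = refl
    clausal-value (_ ∷ xs) r v≈ =
      ∧-cong (∨-cong (¬-cong (v≈ 0)) (v≈ 1)) (clausal-value xs (r ∘ suc ∘ suc) (v≈ ∘ suc ∘ suc))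

    clausal-entries : ∀ x p {v} → (∀ n → v n ≈ j (entries x n)) →
      ⟦_⟧ A (clausal (x p) (pair p)) v ≈ ⟪ x p ⟫
    clausal-entries x p v≈ = clausal-value (x p) (pair p) λ n →
      trans (v≈ (pair p n))
        (reflexive (≡.cong (λ (q , m) → j (entry (x q) m)) (unpair-pair p n)))

-- The logic of the generated variety of envelopes

module _ (B : S4Algebra c ℓ) where
  open S4Algebra B

  opens-isGMTMap : IsGMTMap (rawHeyting (opens B)) B proj₁
  opens-isGMTMap = record
    { isLatticeMap = record
      { ∧-homo = λ _ _ → refl
      ; ∨-homo = λ _ _ → refl
      ; ⊤-homo = refl
      ; ⊥-homo = refl
      }
    ; ⇨-homo = λ _ _ → refl
    }

≅ᴴ-refl : (H : HeytingAlgebra c ℓ₁ ℓ₂) → H ≅ᴴ H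
≅ᴴ-refl H = id , record
  { cong   = id
  ; ∧-homo = λ _ _ → Eq.refl
  ; ∨-homo = λ _ _ → Eq.refl
  ; ⇨-homo = λ _ _ → Eq.refl
  ; ⊤-homo = Eq.refl
  ; ⊥-homo = Eq.refl
  } , id , λ y → y , id
  where open HeytingAlgebra H

-- Let H be isomorphic to the opens of B.  A formula that is true in B at all
-- modal combinations of opens is valid in the envelope of H.
module EnvelopeOfOpens (B : S4Algebra c ℓ) (H : HeytingAlgebra (c ⊔ ℓ) ℓ ℓ)
  (opens≅H : opens B ≅ᴴ H) (O : EnvelopeOperator H) where
  private
    module B = S4Algebra B
    module H = HeytingAlgebra H
    module E = S4Algebra (EnvelopeOperator.algebra O)
    module ⟪⟫ᴱ where
      open Envelope H public
      open Value (rawHeyting H) E.booleanAlgebra (ι H) public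
    module Oᴮ = HeytingAlgebra (opens B)
    D = rawHeyting (opens B)
    f = proj₁ opens≅H
    module f = IsHeytingHomomorphism (proj₁ (proj₂ opens≅H))
    surj = proj₂ (proj₂ (proj₂ opens≅H))
  open BooleanOrder (envelope H)

  -- Opens of B as elements of the envelope.
  j : Oᴮ.Carrier → E.Carrier
  j = ι H ∘ f

  private
    module ι = IsGMTMap (⟪⟫ᴱ.ι-isGMTMap O)
    ι-cong = ⟪⟫ᴱ.ι-cong

  j-isGMTMap : IsGMTMap D (EnvelopeOperator.algebra O) j
  j-isGMTMap = record
    { isLatticeMap = record
      { ∧-homo = λ x y → E.trans {j (x Oᴮ.∧ y)} {ι H (f x H.∧ f y)} {j x E.∧ j y}
          (ι-cong (f.∧-homo x y)) (ι.∧-homo (f x) (f y))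
      ; ∨-homo = λ x y → E.trans {j (x Oᴮ.∨ y)} {ι H (f x H.∨ f y)} {j x E.∨ j y}
          (ι-cong (f.∨-homo x y)) (ι.∨-homo (f x) (f y))
      ; ⊤-homo = E.trans {j Oᴮ.⊤} {ι H H.⊤} {E.⊤} (ι-cong f.⊤-homo) ι.⊤-homo
      ; ⊥-homo = E.trans {j Oᴮ.⊥} {ι H H.⊥} {E.⊥} (ι-cong f.⊥-homo) ι.⊥-homo
      }
    ; ⇨-homo = λ x y →
        E.trans {j (x Oᴮ.⇨ y)} {ι H (f x H.⇨ f y)} {E.□ (E.¬ j x E.∨ j y)}
          (ι-cong (f.⇨-homo x y)) (ι.⇨-homo (f x) (f y))
    }

  j-mono : ∀ {x y} → x Oᴮ.≤ y → j x ≤ j y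
  j-mono {x} {y} x≤y = ⟪⟫ᴱ.ι-mono (H.trans
    (H.reflexive (H.Eq.trans (f.cong {x} {x Oᴮ.∧ y} x≤y) (f.∧-homo x y)))
    (H.x∧y≤y (f x) (f y)))

  open Value D E.booleanAlgebra j

  -- Entries in H replaced by preimages among the opens of B.
  pullback : NF (rawHeyting H) → NF D
  pullback = map λ (c , d) → proj₁ (surj c) , proj₁ (surj d)

  ⟪pullback⟫ : ∀ xs → ⟪⟫ᴱ.⟪ xs ⟫ E.≈ ⟪ pullback xs ⟫
  ⟪pullback⟫ []             = E.refl {E.⊤}
  ⟪pullback⟫ ((c , d) ∷ xs) =
    E.∧-cong {E.¬ ι H c E.∨ ι H d} {E.¬ j c′ E.∨ j d′} {⟪⟫ᴱ.⟪ xs ⟫} {⟪ pullback xs ⟫}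
      (E.∨-cong {E.¬ ι H c} {E.¬ j c′} {ι H d} {j d′}
        (E.¬-cong {ι H c} {j c′} (preimage c)) (preimage d))
      (⟪pullback⟫ xs)
    where
    c′ = proj₁ (surj c)
    d′ = proj₁ (surj d)
    preimage : ∀ x → ι H x E.≈ j (proj₁ (surj x))
    preimage x = ι-cong (H.Eq.sym (proj₂ (surj x) {proj₁ (surj x)} B.refl))

  valid : ∀ φ → (∀ s (u : ℕ → Oᴮ.Carrier) → ⟦_⟧ B φ (λ p → ⟦_⟧ B (s p) (proj₁ ∘ u)) B.≈ B.⊤) →
    EnvelopeOperator.algebra O ⊨ φ
  valid φ φ-true w = truth-transfer (opens-isGMTMap B) j-isGMTMap
    (λ {x} {y} → j-mono {x} {y}) φ x
    (λ p → clausal-entries {D = D} B proj₁ x p λ _ → B.refl)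
    (λ p → E.trans {w p} {⟪⟫ᴱ.⟪ y p ⟫} {⟪ x p ⟫}
      (E.sym {⟪⟫ᴱ.⟪ y p ⟫} {w p} (⟪⟫ᴱ.⟪normalForm⟫ (proj₂ (w p)))) (⟪pullback⟫ (y p)))
    (φ-true (λ p → clausal (x p) (pair p)) (entries x))
    where
    y : ℕ → NF (rawHeyting H)
    y p = ⟪⟫ᴱ.normalForm (proj₂ (w p))
    x : ℕ → NF D
    x p = pullback (y p)

-- The subalgebra of B generated by the values of v, with formulas as its
-- elements, so that it is countable.
module TermAlgebra (B : S4Algebra c ℓ) (v : ℕ → S4Algebra.Carrier B) where
  open S4Algebra B

  -- The lifting only adjusts the universe level.
  value : Lift c Modal → Carrier
  value (lift φ) = ⟦_⟧ B φ v

  terms : S4Algebra c ℓ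
  terms = record
    { booleanAlgebra = record
      { Carrier = Lift c Modal
      ; _≈_ = _≈_ on value
      ; _∨_ = λ (lift φ) (lift ψ) → lift (φ ∨ᶠ ψ)
      ; _∧_ = λ (lift φ) (lift ψ) → lift (φ ∧ᶠ ψ)
      ; ¬_  = λ (lift φ) → lift (¬ᶠ φ)
      ; ⊤   = lift ⊤ᶠ
      ; ⊥   = lift ⊥ᶠ
      ; isBooleanAlgebra = record
        { isDistributiveLattice = record
          { isLattice = record
            { isEquivalence = record { refl = refl ; sym = sym ; trans = trans }
            ; ∨-comm  = λ _ _ → ∨-comm _ _
            ; ∨-assoc = λ _ _ _ → ∨-assoc _ _ _
            ; ∨-cong  = ∨-cong
            ; ∧-comm  = λ _ _ → ∧-comm _ _
            ; ∧-assoc = λ _ _ _ → ∧-assoc _ _ _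
            ; ∧-cong  = ∧-cong
            ; absorptive = (λ _ _ → ∨-absorbs-∧ _ _) , (λ _ _ → ∧-absorbs-∨ _ _)
            }
          ; ∨-distrib-∧ = (λ _ _ _ → ∨-distribˡ-∧ _ _ _) , (λ _ _ _ → ∨-distribʳ-∧ _ _ _)
          ; ∧-distrib-∨ = (λ _ _ _ → ∧-distribˡ-∨ _ _ _) , (λ _ _ _ → ∧-distribʳ-∨ _ _ _)
          }
        ; ∨-complement = (λ _ → ∨-complementˡ _) , (λ _ → ∨-complementʳ _)
        ; ∧-complement = (λ _ → ∧-complementˡ _) , (λ _ → ∧-complementʳ _)
        ; ¬-cong = ¬-cong
        }
      }
    ; □ = λ (lift φ) → lift (□ᶠ φ)
    ; isS4Operator = record
      { □-cong = □-cong
      ; □-⊤    = □-⊤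
      ; □-∧    = λ _ _ → □-∧ _ _
      ; □-T    = λ _ → S4Algebra.□-T B _
      ; □-4    = λ _ → S4Algebra.□-4 B _
      }
    }

  value-isS4Homomorphism : IsS4Homomorphism terms B value
  value-isS4Homomorphism = record
    { isLatticeHomomorphism = record
      { isRelHomomorphism = record { cong = id }
      ; ∧-homo = λ _ _ → refl
      ; ∨-homo = λ _ _ → refl
      }
    ; ⊤-homo = refl
    ; ⊥-homo = refl
    ; ¬-homo = λ _ → refl
    ; □-homo = λ _ → refl
    }

  terms↪ : terms ↪ B
  terms↪ = value , value-isS4Homomorphism , id

  open HeytingAlgebra (opens terms) using () renaming (Carrier to Opens; _≈_ to _≈ᵒ_)

  -- Every open is of this form, since an open x equals □ x.
  openTerm : Modal → Opens
  openTerm φ = lift (□ᶠ φ) , □□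
    where
    open BooleanOrder booleanAlgebra
    □□ : □ (⟦_⟧ B φ v) ≈ □ (□ (⟦_⟧ B φ v))
    □□ = antisym (S4Algebra.□-4 B _) (S4Algebra.□-T B _)

  openTerm-surjective : ∀ x → ∃[ n ] openTerm (formula n) ≈ᵒ x
  openTerm-surjective (lift φ , φ≈□φ) with n , ≡.refl ← formula-surjective φ = n , sym φ≈□φ

module _ (em : ExcludedMiddle ℓ) (K : Pred (S4Algebra ℓ ℓ) k) (K-variety : IsVariety K) where
  open IsVariety K-variety

  Log-σρ⊆ : Log (σ (ρᵛ K)) ⊆ Schem (Log K ^□)
  Log-σρ⊆ {φ} φ∈ s {B} B∈K v =
    B.trans (B.reflexive (⟦⟧-[□] B φ s v))
      (B.trans (B.sym (⟦⟧-cong B φ (λ p → ⟦⟧-homo value-isS4Homomorphism (s p) _)))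
        (B.trans (B.sym (⟦⟧-homo value-isS4Homomorphism φ _)) true-in-C))
    where
    module B = S4Algebra B
    open TermAlgebra B v
    module C = S4Algebra terms
    H = opens terms
    open CountablePrimeFilters em H (openTerm ∘ formula) openTerm-surjective
    open Envelope H
    O : EnvelopeOperator H
    O = envelopeOperator ι-reflects-≤
    E = EnvelopeOperator.algebra O
    module E = S4Algebra E
    H∈ρ : H ∈ ρᵛ K
    H∈ρ = terms , 𝕊-closed (B , B∈K , terms↪) , ≅ᴴ-refl H
    E∈σ : E ∈ σ (ρᵛ K)
    E∈σ = ⊆ℍ𝕊ℙ (Envelopes (ρᵛ K)) {E} B[ H∈ρ , O ]
    open NormalForm (rawHeyting H)
    module Vᴱ = GMTMapProperties (ι-isGMTMap O)
    module Vᶜ = GMTMapProperties (opens-isGMTMap terms)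
    letters : ℕ → NF (rawHeyting H)
    letters n = unit (openTerm (var n))
    true-in-C : ⟦_⟧ terms φ (λ p → ⟦_⟧ terms (s p) (λ n → lift (□ᶠ (var n)))) C.≈ C.⊤
    true-in-C = truth-transfer (ι-isGMTMap O) (opens-isGMTMap terms)
      (λ {x} {y} → ι-reflects-≤ {x} {y}) φ (λ p → nf (s p) letters)
      {λ p → ⟦_⟧ E (s p) (λ n → ι H (openTerm (var n)))}
      (λ p → Vᴱ.nf-value (s p) letters {λ n → ι H (openTerm (var n))}
        (λ n → E.sym {Vᴱ.⟪ letters n ⟫} {ι H (openTerm (var n))} (Vᴱ.⟪unit⟫ (openTerm (var n)))))
      (λ p → Vᶜ.nf-value (s p) letters
        (λ n → C.sym {Vᶜ.⟪ letters n ⟫} {lift (□ᶠ (var n))} (Vᶜ.⟪unit⟫ (openTerm (var n)))))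
      (φ∈ E∈σ _)

  ⊆Log-σρ : Schem (Log K ^□) ⊆ Log (σ (ρᵛ K))
  ⊆Log-σρ {φ} φ∈ {A} =
    Log-ℍ _ {φ} (λ {A} → Log-𝕊 _ {φ} (λ {A} → Log-ℙ _ {φ} (λ {A} → envelopes {A}) {A}) {A}) {A}
    where
    envelopes : φ ∈ Log (Envelopes (ρᵛ K))
    envelopes (B[_,_] {H} (B , B∈K , opens≅H) O) = EnvelopeOfOpens.valid B H opens≅H O φ λ s u →
      let open S4Algebra B in
      trans (⟦⟧-cong B φ (λ p → ⟦⟧-cong B (s p) (proj₂ ∘ u)))
        (trans (reflexive (≡.sym (⟦⟧-[□] B φ s (proj₁ ∘ u)))) (φ∈ s B∈K (proj₁ ∘ u)))

-- Soundness of intuitionistic logic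

module HeytingSemantics (H : HeytingAlgebra c ℓ₁ ℓ₂) (v : ℕ → HeytingAlgebra.Carrier H) where
  open HeytingAlgebra H
  open HeytingProperties H using (⇨-eval; y≤x⇨y; ⇨-distribˡ-∨-∧-≥)

  -- The value of an intuitionistic formula at v.
  ⟦_⟧ⁱ : Int → Carrier
  ⟦ varⁱ p ⟧ⁱ = v p
  ⟦ ⊤ⁱ ⟧ⁱ     = ⊤
  ⟦ ⊥ⁱ ⟧ⁱ     = ⊥
  ⟦ φ ∧ⁱ ψ ⟧ⁱ = ⟦ φ ⟧ⁱ ∧ ⟦ ψ ⟧ⁱ
  ⟦ φ ∨ⁱ ψ ⟧ⁱ = ⟦ φ ⟧ⁱ ∨ ⟦ ψ ⟧ⁱ
  ⟦ φ ⇒ⁱ ψ ⟧ⁱ = ⟦ φ ⟧ⁱ ⇨ ⟦ ψ ⟧ⁱ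

  private
    intro : ∀ {x y} → x ≤ y → ⊤ ≤ x ⇨ y
    intro p = transpose-⇨ (trans (x∧y≤y _ _) p)

    apply : ∀ {w x y} → w ≤ x ⇨ y → w ≤ x → w ≤ y
    apply p q = trans (∧-greatest p q) ⇨-eval

  IPC-sound : ∀ {φ} → φ ∈ IPC → ⊤ ≤ ⟦ φ ⟧ⁱ
  IPC-sound (mp p q)                = apply (IPC-sound q) (IPC-sound p)
  IPC-sound (axiom (K-axiom φ ψ))   = intro y≤x⇨y
  IPC-sound (axiom (S-axiom φ ψ χ)) = intro (transpose-⇨ (transpose-⇨
    (apply (apply (trans (x∧y≤x _ _) (x∧y≤x _ _)) (x∧y≤y _ _))
           (apply (trans (x∧y≤x _ _) (x∧y≤y _ _)) (x∧y≤y _ _)))))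
  IPC-sound (axiom (∧-fst φ ψ))     = intro (x∧y≤x _ _)
  IPC-sound (axiom (∧-snd φ ψ))     = intro (x∧y≤y _ _)
  IPC-sound (axiom (∧-pair φ ψ))    = intro (transpose-⇨ refl)
  IPC-sound (axiom (∨-inl φ ψ))     = intro (x≤x∨y _ _)
  IPC-sound (axiom (∨-inr φ ψ))     = intro (y≤x∨y _ _)
  IPC-sound (axiom (∨-case φ ψ χ))  = intro (transpose-⇨ (⇨-distribˡ-∨-∧-≥ _ _ _))
  IPC-sound (axiom ⊤-intro)         = refl
  IPC-sound (axiom (⊥-elim φ))      = intro (minimum _)

-- The Lindenbaum algebra of S4

module Lindenbaum where

  infix 4 _⊢_ _≈_
  infixl 5 _·_

  -- The order and the equality of the Lindenbaum algebra.
  _⊢_ : Modal → Modal → Set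
  φ ⊢ ψ = (φ ⇒ᶠ ψ) ∈ S4

  _≈_ : Modal → Modal → Set
  φ ≈ ψ = φ ⊢ ψ × ψ ⊢ φ

  const : ∀ {φ ψ} → ψ ∈ S4 → φ ⊢ ψ
  const p = S4.mp p (S4.axiom (K-axiom _ _))

  _·_ : ∀ {χ φ ψ} → χ ⊢ φ ⇒ᶠ ψ → χ ⊢ φ → χ ⊢ ψ
  p · q = S4.mp q (S4.mp p (S4.axiom (S-axiom _ _ _)))

  ⊢-refl : ∀ {φ} → φ ⊢ φ
  ⊢-refl {φ} = S4.axiom (K-axiom φ (φ ⇒ᶠ φ)) · S4.axiom (K-axiom φ φ)

  ⊢-trans : ∀ {φ ψ χ} → φ ⊢ ψ → ψ ⊢ χ → φ ⊢ χ
  ⊢-trans p q = const q · p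

  fst : ∀ {φ ψ} → φ ∧ᶠ ψ ⊢ φ
  fst = S4.axiom (∧-fst _ _)

  snd : ∀ {φ ψ} → φ ∧ᶠ ψ ⊢ ψ
  snd = S4.axiom (∧-snd _ _)

  both : ∀ {χ φ ψ} → χ ⊢ φ → χ ⊢ ψ → χ ⊢ φ ∧ᶠ ψ
  both p q = const (S4.axiom (∧-pair _ _)) · p · q

  cases : ∀ {φ ψ χ} → φ ⊢ χ → ψ ⊢ χ → φ ∨ᶠ ψ ⊢ χ
  cases p q = S4.mp q (S4.mp p (S4.axiom (∨-case _ _ _)))

  curry : ∀ {χ φ ψ} → χ ∧ᶠ φ ⊢ ψ → χ ⊢ φ ⇒ᶠ ψ
  curry p = ⊢-trans (S4.axiom (∧-pair _ _)) (S4.mp (const p) (S4.axiom (S-axiom _ _ _)))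

  uncurry : ∀ {χ φ ψ} → χ ⊢ φ ⇒ᶠ ψ → χ ∧ᶠ φ ⊢ ψ
  uncurry p = ⊢-trans fst p · snd

  heytingAlgebra : HeytingAlgebra 0ℓ 0ℓ 0ℓ
  heytingAlgebra = record
    { Carrier = Modal
    ; _≈_ = _≈_
    ; _≤_ = _⊢_
    ; _∨_ = _∨ᶠ_
    ; _∧_ = _∧ᶠ_
    ; _⇨_ = _⇒ᶠ_
    ; ⊤ = ⊤ᶠ
    ; ⊥ = ⊥ᶠ
    ; isHeytingAlgebra = record
      { isBoundedLattice = record
        { isLattice = record
          { isPartialOrder = record
            { isPreorder = record
              { isEquivalence = record
                { refl  = ⊢-refl , ⊢-refl
                ; sym   = λ (p , q) → q , p
                ; trans = λ (p , q) (r , s) → ⊢-trans p r , ⊢-trans s q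
                }
              ; reflexive = proj₁
              ; trans = ⊢-trans
              }
            ; antisym = _,_
            }
          ; supremum = λ _ _ → S4.axiom (∨-inl _ _) , S4.axiom (∨-inr _ _) , λ _ → cases
          ; infimum = λ _ _ → fst , snd , λ _ → both
          }
        ; maximum = λ _ → const (S4.axiom ⊤-intro)
        ; minimum = λ _ → S4.axiom (⊥-elim _)
        }
      ; exponential = λ _ _ _ → curry , uncurry
      }
    }

  booleanAlgebra : BooleanAlgebra 0ℓ 0ℓ
  booleanAlgebra = record
    { Carrier = Modal
    ; _≈_ = _≈_
    ; _∨_ = _∨ᶠ_
    ; _∧_ = _∧ᶠ_
    ; ¬_ = ¬ᶠ_
    ; ⊤ = ⊤ᶠ
    ; ⊥ = ⊥ᶠ
    ; isBooleanAlgebra = isBooleanAlgebraʳ (record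
      { isDistributiveLattice = isDistributiveLatticeʳʲᵐ (record
        { isLattice    = LatticeProperties.isAlgLattice (HeytingAlgebra.lattice heytingAlgebra)
        ; ∨-distribʳ-∧ = DistributiveLatticeProperties.∨-distribʳ-∧
                           (HeytingProperties.distributiveLattice heytingAlgebra)
        })
      ; ∨-complementʳ = λ φ → const (S4.axiom ⊤-intro) , const (S4.exm φ)
      ; ∧-complementʳ = λ φ → ⊢-trans snd (S4.¬-elim φ) · fst , S4.axiom (⊥-elim _)
      ; ¬-cong        = λ (p , q) → ¬-antitone q , ¬-antitone p
      })
    }
    where
    ¬-antitone : ∀ {φ ψ} → ψ ⊢ φ → ¬ᶠ φ ⊢ ¬ᶠ ψ
    ¬-antitone p = ⊢-trans (curry (⊢-trans fst (S4.¬-elim _) · ⊢-trans snd p)) (S4.¬-intro _)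

  □-mono : ∀ {φ ψ} → φ ⊢ ψ → □ᶠ φ ⊢ □ᶠ ψ
  □-mono p = S4.mp (S4.nec p) (S4.□-K _ _)

  algebra : S4Algebra 0ℓ 0ℓ
  algebra = record
    { booleanAlgebra = booleanAlgebra
    ; □ = □ᶠ_
    ; isS4Operator = record
      { □-cong = λ (p , q) → □-mono p , □-mono q
      ; □-⊤    = const (S4.axiom ⊤-intro) , const (S4.nec (S4.axiom ⊤-intro))
      ; □-∧    = λ _ _ → both (□-mono fst) (□-mono snd)
                       , uncurry (⊢-trans (□-mono (S4.axiom (∧-pair _ _))) (S4.□-K _ _))
      ; □-T    = λ φ → both ⊢-refl (S4.□-T φ) , fst
      ; □-4    = λ φ → both ⊢-refl (S4.□-4 φ) , fst
      }
    }

  open S4Algebra algebra public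
    using (trans; sym; ∧-cong; ∨-cong; ¬-cong; □-cong)
    renaming (refl to ≈-refl; reflexive to ≈-reflexive)

  ⟦⟧≡[] : ∀ φ s → ⟦_⟧ algebra φ s ≡ φ [ s ]
  ⟦⟧≡[] (var p)  s = ≡.refl
  ⟦⟧≡[] ⊤ᶠ       s = ≡.refl
  ⟦⟧≡[] ⊥ᶠ       s = ≡.refl
  ⟦⟧≡[] (φ ∧ᶠ ψ) s = ≡.cong₂ _∧ᶠ_ (⟦⟧≡[] φ s) (⟦⟧≡[] ψ s)
  ⟦⟧≡[] (φ ∨ᶠ ψ) s = ≡.cong₂ _∨ᶠ_ (⟦⟧≡[] φ s) (⟦⟧≡[] ψ s)
  ⟦⟧≡[] (¬ᶠ φ)   s = ≡.cong ¬ᶠ_ (⟦⟧≡[] φ s)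
  ⟦⟧≡[] (□ᶠ φ)   s = ≡.cong □ᶠ_ (⟦⟧≡[] φ s)

  -- The Gödel translation

  □-idem : ∀ φ → □ᶠ φ ≈ □ᶠ (□ᶠ φ)
  □-idem φ = S4.□-4 φ , S4.□-T (□ᶠ φ)

  -- The translation evaluates intuitionistic formulas in the Heyting algebra of
  -- opens.
  open HeytingSemantics (opens algebra) (λ p → □ᶠ (var p) , □-idem (var p)) using (⟦_⟧ⁱ; IPC-sound)

  ⟦⟧ⁱ≡GMT : ∀ φ → proj₁ ⟦ φ ⟧ⁱ ≡ GMT φ
  ⟦⟧ⁱ≡GMT (varⁱ p) = ≡.refl
  ⟦⟧ⁱ≡GMT ⊤ⁱ       = ≡.refl
  ⟦⟧ⁱ≡GMT ⊥ⁱ       = ≡.refl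
  ⟦⟧ⁱ≡GMT (φ ∧ⁱ ψ) = ≡.cong₂ _∧ᶠ_ (⟦⟧ⁱ≡GMT φ) (⟦⟧ⁱ≡GMT ψ)
  ⟦⟧ⁱ≡GMT (φ ∨ⁱ ψ) = ≡.cong₂ _∨ᶠ_ (⟦⟧ⁱ≡GMT φ) (⟦⟧ⁱ≡GMT ψ)
  ⟦⟧ⁱ≡GMT (φ ⇒ⁱ ψ) =
    ≡.cong₂ (λ x y → □ᶠ (¬ᶠ x ∨ᶠ y)) (⟦⟧ⁱ≡GMT φ) (⟦⟧ⁱ≡GMT ψ)

  GMT-open : ∀ φ → GMT φ ≈ □ᶠ (GMT φ)
  GMT-open φ = ≡.subst (λ x → x ≈ □ᶠ x) (⟦⟧ⁱ≡GMT φ) (proj₂ ⟦ φ ⟧ⁱ)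

  GMT-isGMTMap : IsGMTMap formulas algebra GMT
  GMT-isGMTMap = record
    { isLatticeMap = record
      { ∧-homo = λ _ _ → ≈-refl
      ; ∨-homo = λ _ _ → ≈-refl
      ; ⊤-homo = ≈-refl
      ; ⊥-homo = ≈-refl
      }
    ; ⇨-homo = λ _ _ → ≈-refl
    }

  -- In GMT φ every letter stands immediately under a box.
  GMT-[]-cong : ∀ φ {s t} → (∀ p → □ᶠ (s p) ≈ □ᶠ (t p)) → GMT φ [ s ] ≈ GMT φ [ t ]
  GMT-[]-cong (varⁱ p) s≈t = s≈t p
  GMT-[]-cong ⊤ⁱ       s≈t = ≈-refl
  GMT-[]-cong ⊥ⁱ       s≈t = ≈-refl
  GMT-[]-cong (φ ∧ⁱ ψ) s≈t = ∧-cong (GMT-[]-cong φ s≈t) (GMT-[]-cong ψ s≈t)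
  GMT-[]-cong (φ ∨ⁱ ψ) s≈t = ∨-cong (GMT-[]-cong φ s≈t) (GMT-[]-cong ψ s≈t)
  GMT-[]-cong (φ ⇒ⁱ ψ) s≈t = □-cong (∨-cong (¬-cong (GMT-[]-cong φ s≈t)) (GMT-[]-cong ψ s≈t))

  GMT-[] : ∀ φ s → GMT (φ [ s ]ⁱ) ≈ GMT φ [ GMT ∘ s ]
  GMT-[] (varⁱ p) s = GMT-open (s p)
  GMT-[] ⊤ⁱ       s = ≈-refl
  GMT-[] ⊥ⁱ       s = ≈-refl
  GMT-[] (φ ∧ⁱ ψ) s = ∧-cong (GMT-[] φ s) (GMT-[] ψ s)
  GMT-[] (φ ∨ⁱ ψ) s = ∨-cong (GMT-[] φ s) (GMT-[] ψ s)
  GMT-[] (φ ⇒ⁱ ψ) s = □-cong (∨-cong (¬-cong (GMT-[] φ s)) (GMT-[] ψ s))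

  [var] : ∀ φ → φ [ var ] ≡ φ
  [var] (var p)  = ≡.refl
  [var] ⊤ᶠ       = ≡.refl
  [var] ⊥ᶠ       = ≡.refl
  [var] (φ ∧ᶠ ψ) = ≡.cong₂ _∧ᶠ_ ([var] φ) ([var] ψ)
  [var] (φ ∨ᶠ ψ) = ≡.cong₂ _∨ᶠ_ ([var] φ) ([var] ψ)
  [var] (¬ᶠ φ)   = ≡.cong ¬ᶠ_ ([var] φ)
  [var] (□ᶠ φ)   = ≡.cong □ᶠ_ ([var] φ)

  GMT-[□] : ∀ φ → GMT φ ≈ GMT φ [ (λ p → □ᶠ (var p)) ]
  GMT-[□] φ = trans (≈-reflexive (≡.sym ([var] (GMT φ)))) (GMT-[]-cong φ (□-idem ∘ var))

  -- An intuitionistic formula whose translation is equivalent to □ (φ [□p/p]): the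
  -- entries of the clausal normal form of φ [□p/p] are intuitionistic formulas, and
  -- the letter p stands for GMT (varⁱ p), which is □p.
  skeleton : Modal → Int
  skeleton φ = interior (nf φ (unit ∘ varⁱ))
    where open NormalForm formulas

  □-[□] : ∀ φ → □ᶠ (φ [ (λ p → □ᶠ (var p)) ]) ≈ GMT (skeleton φ)
  □-[□] φ = trans
    (□-cong (trans (≈-reflexive (≡.sym (⟦⟧≡[] φ _)))
      (nf-value φ (unit ∘ varⁱ) (λ p → sym {⟪ unit (varⁱ p) ⟫} {□ᶠ (var p)} (⟪unit⟫ (varⁱ p))))))
    (□⟪⟫ (nf φ (unit ∘ varⁱ)))
    where
    open NormalForm formulas
    open GMTMapProperties GMT-isGMTMap

  ∈S4⇐⊤ : ∀ {φ} → ⊤ᶠ ⊢ φ → φ ∈ S4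
  ∈S4⇐⊤ p = S4.mp (S4.axiom ⊤-intro) p

  IPC⇒S4 : ∀ {φ} → φ ∈ IPC → GMT φ ∈ S4
  IPC⇒S4 {φ} p = ≡.subst (_∈ S4) (⟦⟧ⁱ≡GMT φ) (∈S4⇐⊤ (⊢-trans (proj₁ (IPC-sound p)) snd))

-- Modal companions

module _ {m} {L : Pred Modal m} (L-normal : NExt⟨S4⟩ L) where
  open NExt⟨S4⟩ L-normal
  open Lindenbaum hiding (trans; sym)

  ∈-resp-⊢ : ∀ {φ ψ} → φ ⊢ ψ → φ ∈ L → ψ ∈ L
  ∈-resp-⊢ p φ∈L = mp-closed φ∈L (extends p)

  ρᴸ-superintuitionistic : Λ⟨IPC⟩ (ρᴸ L)
  ρᴸ-superintuitionistic = record
    { extends      = λ p → extends (IPC⇒S4 p)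
    ; mp-closed    = λ p q → mp-closed p (∈-resp-⊢ (S4.□-T _) q)
    ; subst-closed = λ {φ} s p → ∈-resp-⊢ (proj₂ (GMT-[] φ s)) (subst-closed (GMT ∘ s) p)
    }

  ρᴸ-companion : IsModalCompanion L (ρᴸ L)
  ρᴸ-companion = record
    { normal              = L-normal
    ; superintuitionistic = ρᴸ-superintuitionistic
    ; companion           = λ _ → mk⇔ id id
    }

  ^□⇒ρᴸ : ∀ φ → φ ∈ L ^□ → skeleton φ ∈ ρᴸ L
  ^□⇒ρᴸ φ p = ∈-resp-⊢ (proj₁ (□-[□] φ)) (nec-closed p)

  ρᴸ⇒^□ : ∀ φ → skeleton φ ∈ ρᴸ L → φ ∈ L ^□
  ρᴸ⇒^□ φ p = ∈-resp-⊢ (S4.□-T _) (∈-resp-⊢ (proj₂ (□-[□] φ)) p)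

  GMT∈^□ : ∀ φ → GMT φ ∈ L → GMT φ ∈ L ^□
  GMT∈^□ φ = ∈-resp-⊢ (proj₁ (GMT-[□] φ))

  GMT∈^□⁻ : ∀ φ → GMT φ ∈ L ^□ → GMT φ ∈ L
  GMT∈^□⁻ φ = ∈-resp-⊢ (proj₂ (GMT-[□] φ))

-- The □-variant of a normal extension of S4 and its intuitionistic fragment determine
-- each other, monotonically.
module _ {m n} {L : Pred Modal m} {S : Pred Modal n}
         (L-normal : NExt⟨S4⟩ L) (S-normal : NExt⟨S4⟩ S) where

  ρᴸ⊆⇒^□⊆ : ρᴸ L ⊆ ρᴸ S → L ^□ ⊆ S ^□
  ρᴸ⊆⇒^□⊆ ρL⊆ρS {φ} p =
    ρᴸ⇒^□ S-normal φ (ρL⊆ρS {Lindenbaum.skeleton φ} (^□⇒ρᴸ L-normal φ p))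

  ^□⊆⇒ρᴸ⊆ : L ^□ ⊆ S ^□ → ρᴸ L ⊆ ρᴸ S
  ^□⊆⇒ρᴸ⊆ L□⊆S□ {φ} p = GMT∈^□⁻ S-normal φ (L□⊆S□ {GMT φ} (GMT∈^□ L-normal φ p))

module _ {m} {L : Pred Modal m} (L-normal : NExt⟨S4⟩ L) where

  □-maximal⇒greatest : □-Maximal L → IsGreatestModalCompanion L (ρᴸ L)
  □-maximal⇒greatest maximal = ρᴸ-companion L-normal , λ S S-companion →
    let open IsModalCompanion S-companion in
    maximal S normal
      ( (λ {φ} → ρᴸ⊆⇒^□⊆ L-normal normal (λ {ψ} → Equivalence.to (companion ψ)) {φ})
      , (λ {φ} → ρᴸ⊆⇒^□⊆ normal L-normal (λ {ψ} → Equivalence.from (companion ψ)) {φ}))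

  greatest⇒□-maximal : IsGreatestModalCompanion L (ρᴸ L) → □-Maximal L
  greatest⇒□-maximal (_ , greatest) S S-normal (L□⊆S□ , S□⊆L□) = greatest S record
    { normal              = S-normal
    ; superintuitionistic = ρᴸ-superintuitionistic L-normal
    ; companion           = λ φ → mk⇔
        (^□⊆⇒ρᴸ⊆ L-normal S-normal (λ {ψ} → L□⊆S□ {ψ}) {φ})
        (^□⊆⇒ρᴸ⊆ S-normal L-normal (λ {ψ} → S□⊆L□ {ψ}) {φ})
    }

corollary6p8 : ∀ {ℓ k m} → ExcludedMiddle ℓ →
    (∀ (K : Pred (S4Algebra ℓ ℓ) k) → IsVariety K →
    Log (σ (ρᵛ K)) ≐ Schem (Log K ^□))
    × (∀ (L : Pred Modal m) → NExt⟨S4⟩ L →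
    □-Maximal L ⇔ IsGreatestModalCompanion L (ρᴸ L))
corollary6p8 em =
    (λ K K-variety → (λ {φ} p → Log-σρ⊆ em K K-variety {φ} (λ {A} → p {A}))
                   , (λ {φ} p {A} → ⊆Log-σρ em K K-variety {φ} p {A}))
  , (λ L L-normal → mk⇔ (□-maximal⇒greatest L-normal) (greatest⇒□-maximal L-normal))
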